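{- Let $\Sigma$ be a closed oriented surface and let $\mathcal T$ be a coherent double circuit configuration on $\Sigma$ in $\mathbb P^d$ ($d\ge 2$). Let $\mathcal T'$ be obtained from $\mathcal T$ by one of the moves (M1) (degree-two vertex removal or addition) or (M2) (urban renewal) described below, where the data are generic, so that all labels of $\mathcal T'$ are well defined (every intersection and span used below is a point, respectively a hyperplane) and $\mathcal T'$ is again a double circuit configuration in which all pairings entering the multi-ratios of its faces are nonzero. Then $\mathcal T'$ is coherent.
   Context: A tiling of a closed oriented surface $\Sigma$ is a bipartite graph $\Gamma$ (vertices colored white and black, each edge joining vertices of different colors) embedded in $\Sigma$ so that every face (connected component of $\Sigma\setminus\Gamma$) is an open disk, together with an assignment of a point of $\mathbb P^d$ to every white vertex and a hyperplane of $\mathbb P^d$ to every black vertex. Each face is a $2n$-gon whose boundary vertices alternate in color. Multi-ratio: for points $A_1,\dots,A_n$ and hyperplanes $\ell_1,\dots,\ell_n$ of $\mathbb P^d$, choose representing vectors $\mathbf A_i\in\mathbb C^{d+1}$ and covectors $\boldsymbol\ell_i$, and set $[A_1,\ell_1,\dots,A_n,\ell_n]=\frac{\boldsymbol\ell_1(\mathbf A_1)\cdots\boldsymbol\ell_n(\mathbf A_n)}{\boldsymbol\ell_1(\mathbf A_2)\cdots\boldsymbol\ell_n(\mathbf A_1)}$ (indices mod $n$; this is independent of the lifts). A face is coherent if the multi-ratio of the labels of its boundary vertices, read in clockwise order (with respect to the orientation of $\Sigma$), equals $1$; a tiling is coherent if every face is coherent. A circuit in a projective space is a linearly dependent set of points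 no proper subset of which is linearly dependent (e.g. two equal points; three pairwise distinct collinear points). Hyperplanes are regarded as points of the dual projective space. A tiling is a double circuit configuration if for every vertex, the labels of its neighbors form a circuit. Moves. (M1) Degree-two vertex removal: if a white vertex labeled $A$ has degree 2 with distinct black neighbors $u,u'$ (which, by the circuit condition, carry the same hyperplane $\ell$), delete this white vertex and its two edges and merge $u,u'$ into one black vertex labeled $\ell$ adjacent to all former neighbors of $u$ and $u'$. The same with colors (points/hyperplanes) interchanged. Degree-two vertex addition is the inverse operation. (M2) Urban renewal: suppose there is a quadrilateral face with boundary vertices, in cyclic order, $A$ (white), $c$ (black), $B$ (white), $d$ (black), where $A$'s other black neighbors are labeled $a_1,\dots,a_m$, $c$'s other white neighbors $C_1,\dots,C_k$, $B$'s other black neighbors $b_1,\dots,b_n$, $d$'s other white neighbors $D_1,\dots,D_l$. Delete the four edges $Ac,cB,Bd,dA$; insert new vertices $g$ (black), $E$ (white), $h$ (black), $F$ (white) forming a new quadrilateral face with cycle $g,E,h,F$, and add edges $A g$, $c E$, $B h$, $d F$ (so the square face is replaced by an inner square and four surrounding quadrilateral faces). The new labels are $E=\langle A,B\rangle\cap\langle C_1,\dots,C_k\rangle$, $F=\langle A,B\rangle\cap\langle D_1,\dots,D_l\rangle$, $g=\langle c\cap d,\ a_1\cap\dots\cap a_m\rangle$, $h=\langle c\cap d,\ b_1\cap\dots\cap b_n\rangle$, where $\langle\cdot\rangle$ denotes span; all other labels are unchanged. -}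

module Defs where

open import Algebra.Apartness.Bundles using (HeytingCommutativeRing; HeytingField)
open import Algebra.Bundles using (CommutativeRing)
import Algebra.Properties.CommutativeMonoid.Sum as Sum
open import Data.Bool.Base using (if_then_else_)
open import Data.Fin.Base using (Fin; toℕ)
open import Data.Fin.Permutation using (Permutation′; _⟨$⟩ʳ_)
open import Data.Fin.Properties using (_≟_)
open import Data.Fin.Subset using (Subset; ⁅_⁆; _∪_; _─_; _⊂_)
  renaming (_∈_ to _∈ˢ_; _∉_ to _∉ˢ_)
open import Data.Nat.Base using (ℕ; zero; suc; _<_)
open import Data.Nat.DivMod using (_mod_)
open import Data.Nat.GeneralisedArithmetic using (fold)
open import Data.Product.Base using (∃; ∃-syntax; _×_; _,_; proj₁)
open import Data.Sum.Base using (_⊎_; inj₁; inj₂)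
open import Data.Unit.Base using (⊤)
open import Data.Vec.Base using (tabulate)
open import Function.Base using (_∘_)
open import Function.Bundles using (_⇔_)
open import Function.Definitions using (Injective)
open import Level using (Level; _⊔_)
open import Relation.Binary.PropositionalEquality.Core using (_≡_; _≢_)
open import Relation.Nullary.Decidable.Core using (does)
open import Relation.Nullary.Negation.Core using (¬_)
open import Relation.Unary using (Pred; _∩_; _≐_)

-- A finite bipartite (multi)graph without isolated vertices, embedded in a
-- closed oriented surface with all faces open disks, encoded by its rotation
-- system: σ∘ e (resp. σ• e) is the edge that follows e in counterclockwise order
-- around the white (resp. black) end of e.  Such data, up to relabelling, are
-- the same thing as such embeddings up to orientation-preserving homeomorphism.
-- The surface is not required to be connected.
record BipartiteMap : Set where
  field
    #edges #white #black : ℕ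

  Edge : Set
  Edge = Fin #edges

  White : Set
  White = Fin #white

  Black : Set
  Black = Fin #black

  field
    white : Edge → White
    black : Edge → Black
    rot∘ rot• : Permutation′ #edges

  σ∘ : Edge → Edge
  σ∘ = rot∘ ⟨$⟩ʳ_

  σ• : Edge → Edge
  σ• = rot• ⟨$⟩ʳ_

  field
    white-onto  : ∀ v → ∃[ e ] white e ≡ v
    black-onto  : ∀ v → ∃[ e ] black e ≡ v
    white-orbit : ∀ e f → (white e ≡ white f) ⇔ (∃[ k ] fold e σ∘ k ≡ f)
    black-orbit : ∀ e f → (black e ≡ black f) ⇔ (∃[ k ] fold e σ• k ≡ f)

  star∘ : White → Subset #edges
  star∘ v = tabulate λ e → does (white e ≟ v)

  star• : Black → Subset #edges
  star• v = tabulate λ e → does (black e ≟ v)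

  -- Traverse e from white to black, leave the black vertex along σ• e, and
  -- arrive at the next white vertex, which is then left along σ∘ (σ• e).  As σ∘
  -- and σ• turn counterclockwise, the face being followed lies on the right, so
  -- its boundary is read clockwise.
  φ : Edge → Edge
  φ e = σ∘ (σ• e)

  -- A 2n-gonal face (n = suc n-1) with a chosen boundary edge, i.e. a φ-orbit of
  -- length n with a chosen element.
  record Face : Set where
    field
      start   : Edge
      n-1     : ℕ
      closed  : fold start φ (suc n-1) ≡ start
      minimal : ∀ k → 0 < k → k < suc n-1 → fold start φ k ≢ start

    edgeAt : Fin (suc n-1) → Edge
    edgeAt i = fold start φ (toℕ i)

-- The eight edges created by urban renewal; the letters name their ends as in
-- the square A c B d and the inner square g E h F.
data NewEdge : Set where
  Ag cE Bh dF : NewEdge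
  gE Eh hF Fg : NewEdge

-- K ranges over all fields, with _#_ as "is different from" (x # 0# is the same
-- as invertibility of x); the case of interest is K = ℂ.
module Tilings {c ℓ₁ ℓ₂ : Level} (K : HeytingField c ℓ₁ ℓ₂) (d : ℕ) where

  open HeytingField K

  private
    module R = CommutativeRing
      (HeytingCommutativeRing.commutativeRing heytingCommutativeRing)
    module ∑ = Sum R.+-commutativeMonoid
    module ∏ = Sum R.*-commutativeMonoid

  ∑ : ∀ {n} → (Fin n → Carrier) → Carrier
  ∑ = ∑.sum

  ∏ : ∀ {n} → (Fin n → Carrier) → Carrier
  ∏ = ∏.sum

  _/_[_] : (x y : Carrier) → y # 0# → Carrier
  x / y [ y#0 ] = x * proj₁ (#⇒invertible y#0)

  -- K^(d+1); covectors are written in the dual basis.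
  Vector : Set c
  Vector = Fin (suc d) → Carrier

  -- A point of ℙ^d, or of the dual ℙ^d, given by a representing vector.
  record Proj : Set (c ⊔ ℓ₂) where
    field
      vec     : Vector
      nonzero : ∃[ j ] vec j # 0#

  open Proj public

  Point Hyperplane : Set (c ⊔ ℓ₂)
  Point      = Proj
  Hyperplane = Proj

  infix 4 _≈ₚ_

  _≈ₚ_ : Proj → Proj → Set (c ⊔ ℓ₁ ⊔ ℓ₂)
  P ≈ₚ Q = ∃[ a ] a # 0# × (∀ j → vec P j ≈ a * vec Q j)

  apply : Hyperplane → Vector → Carrier
  apply ℓ x = ∑ λ j → vec ℓ j * x j

  pair : Hyperplane → Point → Carrier
  pair ℓ A = apply ℓ (vec A)

  next : ∀ {m} → Fin (suc m) → Fin (suc m)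
  next {m} i = suc (toℕ i) mod suc m

  module _ {m : ℕ} (A : Fin (suc m) → Point) (ℓ : Fin (suc m) → Hyperplane) where

    numerator denominator : Carrier
    numerator   = ∏ λ i → pair (ℓ i) (A i)
    denominator = ∏ λ i → pair (ℓ i) (A (next i))

    multiRatio : denominator # 0# → Carrier
    multiRatio nz = numerator / denominator [ nz ]

  combination : ∀ {n} → (Fin n → Carrier) → (Fin n → Proj) → Vector
  combination a P j = ∑ λ i → a i * vec (P i) j

  SupportedOn : ∀ {n} → Subset n → (Fin n → Carrier) → Set ℓ₁
  SupportedOn S a = ∀ i → i ∉ˢ S → a i ≈ 0#

  Dependent : ∀ {n} → Subset n → (Fin n → Proj) → Set (c ⊔ ℓ₁ ⊔ ℓ₂)
  Dependent S P =
    ∃[ a ] SupportedOn S a × (∃[ i ] a i # 0#) × (∀ j → combination a P j ≈ 0#)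

  -- The members of the family P with index in S form a circuit; repetitions
  -- count, so two equal points form a circuit.
  Circuit : ∀ {n} → Subset n → (Fin n → Proj) → Set (c ⊔ ℓ₁ ⊔ ℓ₂)
  Circuit S P = Dependent S P × (∀ S′ → S′ ⊂ S → ¬ Dependent S′ P)

  -- Projective subspaces are handled as linear subspaces of K^(d+1).

  ⟨_⟩ : Point → Pred Vector (c ⊔ ℓ₁)
  ⟨ P ⟩ x = ∃[ a ] (∀ j → x j ≈ a * vec P j)

  ker : Hyperplane → Pred Vector ℓ₁
  ker ℓ x = apply ℓ x ≈ 0#

  infixr 6 _∨_

  _∨_ : ∀ {a b} → Pred Vector a → Pred Vector b → Pred Vector (c ⊔ ℓ₁ ⊔ a ⊔ b)
  (U ∨ V) x = ∃[ u ] ∃[ v ] U u × V v × (∀ j → x j ≈ u j + v j)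

  Span : ∀ {n} → Subset n → (Fin n → Point) → Pred Vector (c ⊔ ℓ₁)
  Span S P x = ∃[ a ] SupportedOn S a × (∀ j → x j ≈ combination a P j)

  Meet : ∀ {n} → Subset n → (Fin n → Hyperplane) → Pred Vector ℓ₁
  Meet S ℓ x = ∀ i → i ∈ˢ S → ker (ℓ i) x

  record Tiling : Set (c ⊔ ℓ₂) where
    field
      bipartiteMap : BipartiteMap

    open BipartiteMap bipartiteMap public

    field
      point      : White → Point
      hyperplane : Black → Hyperplane

    pointAt : Edge → Point
    pointAt e = point (white e)

    hyperplaneAt : Edge → Hyperplane
    hyperplaneAt e = hyperplane (black e)

  open Tiling

  swapColors : Tiling → Tiling
  swapColors T = record
    { bipartiteMap = record
      { #edges      = #edges T
      ; #white      = #black T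
      ; #black      = #white T
      ; white       = black T
      ; black       = white T
      ; rot∘        = rot• T
      ; rot•        = rot∘ T
      ; white-onto  = black-onto T
      ; black-onto  = white-onto T
      ; white-orbit = black-orbit T
      ; black-orbit = white-orbit T
      }
    ; point      = hyperplane T
    ; hyperplane = point T
    }

  CoherentFace : (T : Tiling) → Face T → Set (ℓ₁ ⊔ ℓ₂)
  CoherentFace T F = ∃ λ (nz : denominator A ℓ # 0#) → multiRatio A ℓ nz ≈ 1#
    where
    open BipartiteMap.Face F
    A : Fin (suc n-1) → Point
    A i = pointAt T (edgeAt i)
    ℓ : Fin (suc n-1) → Hyperplane
    ℓ i = hyperplaneAt T (edgeAt i)

  Coherent : Tiling → Set (ℓ₁ ⊔ ℓ₂)
  Coherent T = ∀ F → CoherentFace T F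

  -- Neighbors are counted with multiplicity, one for each incident edge.
  DoubleCircuit : Tiling → Set (c ⊔ ℓ₁ ⊔ ℓ₂)
  DoubleCircuit T =
      (∀ v → Circuit (star∘ T v) (hyperplaneAt T))
    × (∀ v → Circuit (star• T v) (pointAt T))

  -- The pairings in the multi-ratios of the faces are those along the edges.
  NonzeroPairings : Tiling → Set ℓ₂
  NonzeroPairings T = ∀ e → pair (hyperplaneAt T e) (pointAt T e) # 0#

  -- T′ arises from T by removing the white vertex with edges e₁, e₂ and merging
  -- the black ends of these edges.
  record WhiteRemoval (T T′ : Tiling) : Set (c ⊔ ℓ₁ ⊔ ℓ₂) where
    field
      e₁ e₂    : Edge T
      distinct : e₁ ≢ e₂
      degree-2 : σ∘ T e₁ ≡ e₂ × σ∘ T e₂ ≡ e₁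
      ends     : black T e₁ ≢ black T e₂

      ι           : Edge T′ → Edge T
      ι-injective : Injective _≡_ _≡_ ι
      ι-image     : ∀ e → (∃[ e′ ] ι e′ ≡ e) ⇔ (e ≢ e₁ × e ≢ e₂)

    -- Around the merged vertex, the gap left by e₁ is filled with the remaining
    -- edges at the black end of e₂, and vice versa.  (In a double circuit
    -- configuration both black ends have degree at least two.)  The vertices of
    -- T′ need no separate description, being the orbits of its rotations.
    skip : Edge T → Edge T
    skip f = if does (f ≟ e₁) then σ• T e₂
             else if does (f ≟ e₂) then σ• T e₁
             else f

    field
      rotation∘   : ∀ e′ → ι (σ∘ T′ e′) ≡ σ∘ T (ι e′)
      rotation•   : ∀ e′ → ι (σ• T′ e′) ≡ skip (σ• T (ι e′))
      points      : ∀ e′ → pointAt T′ e′ ≈ₚ pointAt T (ι e′)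
      hyperplanes : ∀ e′ → hyperplaneAt T′ e′ ≈ₚ hyperplaneAt T (ι e′)

  -- A quadrilateral face with vertices A, c, B, d in clockwise order, given by
  -- its edges.  (For the counterclockwise order, exchange c with d and E with F.)
  record Square (T : Tiling) : Set where
    field
      Ac cB Bd dA : Edge T
      corner-c    : σ• T Ac ≡ cB
      corner-B    : σ∘ T cB ≡ Bd
      corner-d    : σ• T Bd ≡ dA
      corner-A    : σ∘ T dA ≡ Ac
      not-digon   : Ac ≢ Bd

    A B : Point
    A = pointAt T Ac
    B = pointAt T Bd

    cₕ dₕ : Hyperplane
    cₕ = hyperplaneAt T Ac
    dₕ = hyperplaneAt T Bd

    c∩d : Pred Vector ℓ₁
    c∩d = ker cₕ ∩ ker dₕ

    aMeet bMeet : Pred Vector ℓ₁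
    aMeet = Meet (star∘ T (white T Ac) ─ (⁅ dA ⁆ ∪ ⁅ Ac ⁆)) (hyperplaneAt T)
    bMeet = Meet (star∘ T (white T Bd) ─ (⁅ cB ⁆ ∪ ⁅ Bd ⁆)) (hyperplaneAt T)

    CSpan DSpan : Pred Vector (c ⊔ ℓ₁)
    CSpan = Span (star• T (black T Ac) ─ (⁅ Ac ⁆ ∪ ⁅ cB ⁆)) (pointAt T)
    DSpan = Span (star• T (black T Bd) ─ (⁅ Bd ⁆ ∪ ⁅ dA ⁆)) (pointAt T)

    Survives : Edge T ⊎ NewEdge → Set
    Survives (inj₁ e) = e ≢ Ac × e ≢ cB × e ≢ Bd × e ≢ dA
    Survives (inj₂ _) = ⊤

    -- At each corner of the square, two consecutive edges give way to one leg.
    -- As the successor of an edge, the first of the two (in counterclockwise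
    -- order) is replaced by the leg; the second only succeeds the first.
    leg∘ leg• : Edge T → Edge T ⊎ NewEdge
    leg∘ e = if does (e ≟ dA) then inj₂ Ag
             else if does (e ≟ cB) then inj₂ Bh
             else inj₁ e
    leg• e = if does (e ≟ Ac) then inj₂ cE
             else if does (e ≟ Bd) then inj₂ dF
             else inj₁ e

    -- The new vertices g, E, h, F are in clockwise order, adjacent to A, c, B, d.
    newσ∘ newσ• : Edge T ⊎ NewEdge → Edge T ⊎ NewEdge
    newσ∘ (inj₁ e)  = leg∘ (σ∘ T e)
    newσ∘ (inj₂ Ag) = leg∘ (σ∘ T Ac)
    newσ∘ (inj₂ Bh) = leg∘ (σ∘ T Bd)
    newσ∘ (inj₂ cE) = inj₂ gE
    newσ∘ (inj₂ gE) = inj₂ Eh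
    newσ∘ (inj₂ Eh) = inj₂ cE
    newσ∘ (inj₂ dF) = inj₂ hF
    newσ∘ (inj₂ hF) = inj₂ Fg
    newσ∘ (inj₂ Fg) = inj₂ dF

    newσ• (inj₁ e)  = leg• (σ• T e)
    newσ• (inj₂ cE) = leg• (σ• T cB)
    newσ• (inj₂ dF) = leg• (σ• T dA)
    newσ• (inj₂ Ag) = inj₂ Fg
    newσ• (inj₂ Fg) = inj₂ gE
    newσ• (inj₂ gE) = inj₂ Ag
    newσ• (inj₂ Bh) = inj₂ Eh
    newσ• (inj₂ Eh) = inj₂ hF
    newσ• (inj₂ hF) = inj₂ Bh

  module _ (T : Tiling) where

    newPoint : (A B E F : Point) → Edge T ⊎ NewEdge → Point
    newPoint A B E F (inj₁ e)  = pointAt T e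
    newPoint A B E F (inj₂ Ag) = A
    newPoint A B E F (inj₂ Bh) = B
    newPoint A B E F (inj₂ cE) = E
    newPoint A B E F (inj₂ gE) = E
    newPoint A B E F (inj₂ Eh) = E
    newPoint A B E F (inj₂ dF) = F
    newPoint A B E F (inj₂ hF) = F
    newPoint A B E F (inj₂ Fg) = F

    newHyperplane : (c d g h : Hyperplane) → Edge T ⊎ NewEdge → Hyperplane
    newHyperplane c d g h (inj₁ e)  = hyperplaneAt T e
    newHyperplane c d g h (inj₂ cE) = c
    newHyperplane c d g h (inj₂ dF) = d
    newHyperplane c d g h (inj₂ Ag) = g
    newHyperplane c d g h (inj₂ gE) = g
    newHyperplane c d g h (inj₂ Fg) = g
    newHyperplane c d g h (inj₂ Bh) = h
    newHyperplane c d g h (inj₂ Eh) = h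
    newHyperplane c d g h (inj₂ hF) = h

  record UrbanRenewal (T T′ : Tiling) : Set (c ⊔ ℓ₁ ⊔ ℓ₂) where
    field
      square : Square T

    open Square square public

    -- E, F are points and g, h are hyperplanes: this is the genericity required
    -- for the new labels to be well defined.
    field
      E F : Point
      g h : Hyperplane
      E-label : ((⟨ A ⟩ ∨ ⟨ B ⟩) ∩ CSpan) ≐ ⟨ E ⟩
      F-label : ((⟨ A ⟩ ∨ ⟨ B ⟩) ∩ DSpan) ≐ ⟨ F ⟩
      g-label : (c∩d ∨ aMeet) ≐ ker g
      h-label : (c∩d ∨ bMeet) ≐ ker h

      origin           : Edge T′ → Edge T ⊎ NewEdge
      origin-injective : Injective _≡_ _≡_ origin
      origin-image     : ∀ x → (∃[ e′ ] origin e′ ≡ x) ⇔ Survives x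
      rotation∘        : ∀ e′ → origin (σ∘ T′ e′) ≡ newσ∘ (origin e′)
      rotation•        : ∀ e′ → origin (σ• T′ e′) ≡ newσ• (origin e′)
      points           : ∀ e′ → pointAt T′ e′ ≈ₚ
                                newPoint T A B E F (origin e′)
      hyperplanes      : ∀ e′ → hyperplaneAt T′ e′ ≈ₚ
                                newHyperplane T cₕ dₕ g h (origin e′)

  data Move (T T′ : Tiling) : Set (c ⊔ ℓ₁ ⊔ ℓ₂) where
    white-removal  : WhiteRemoval T T′ → Move T T′
    black-removal  : WhiteRemoval (swapColors T) (swapColors T′) → Move T T′
    white-addition : WhiteRemoval T′ T → Move T T′
    black-addition : WhiteRemoval (swapColors T′) (swapColors T) → Move T T′
    urban-renewal  : UrbanRenewal T T′ → Move T T′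

{-# OPTIONS --safe #-}
module Submission where

-- The faces are the orbits of φ, and coherence says that the cocycle
-- ℓ(A) / ℓ(A′) of an edge with ends A, ℓ followed by the white vertex A′ has
-- product 1 along every closed φ-walk.  This is invariant under cohomology, in
-- particular under the choice of lifts, and each move matches every step of one
-- walk with zero, one or two steps of the other up to a coboundary.  For the
-- removal of a vertex of degree two this is the equality of the hyperplanes at
-- its neighbors.  For urban renewal, coherence of the square means that the line
-- AB meets c and d in the same point, which lies in c ∩ d; so, up to scalars, all
-- hyperplanes through c ∩ d restrict to the same functional on AB, and every
-- quadrilateral with two such hyperplanes and two points of AB is coherent.

open import Defs
open import Algebra.Apartness.Bundles using (HeytingCommutativeRing; HeytingField)
import Algebra.Apartness.Properties.HeytingCommutativeRing as HCRProperties
open import Algebra.Bundles using (CommutativeRing)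
import Algebra.Properties.CommutativeMonoid.Sum as CommutativeMonoidSum
import Algebra.Properties.Group as GroupProperties
import Algebra.Properties.Ring as RingProperties
import Algebra.Properties.Semiring.Sum as SemiringSum
import Algebra.Solver.CommutativeMonoid as CommutativeMonoidSolver
open import Data.Bool.Base using (true)
open import Data.Fin.Base using (Fin; toℕ; fromℕ; inject₁)
open import Data.Fin.Permutation using (_⟨$⟩ˡ_; inverseˡ)
open import Data.Fin.Properties
  using (_≟_; punchInᵢ≢i; toℕ-fromℕ; toℕ-fromℕ<; toℕ-inject₁; toℕ<n; pigeonhole)
open import Data.Nat.Base using (ℕ; zero; suc; _≤_; _<_; s≤s) renaming (_+_ to _+ℕ_)
open import Data.Nat.DivMod using (_%_; m%n<n; m<n⇒m%n≡m; n%n≡0)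
open import Data.Nat.GeneralisedArithmetic using (fold; fold-+)
open import Data.Nat.Induction using (<-rec)
import Data.Nat.Properties as ℕ
open import Data.Product.Base using (∃-syntax; _×_; _,_; proj₁; proj₂)
open import Data.Sum.Base using (_⊎_; inj₁; inj₂)
open import Data.Unit.Base using (tt)
open import Data.Vec.Functional using (removeAt)
open import Data.Vec.Properties using (lookup∘tabulate; []=⇒lookup)
open import Function.Base using (_∘_)
open import Function.Bundles using (Equivalence)
open import Level using (0ℓ; _⊔_) renaming (suc to lsuc)
open import Relation.Binary.PropositionalEquality.Core as ≡ using (_≡_; _≢_)
import Relation.Binary.Reasoning.Setoid as SetoidReasoning
open import Relation.Nullary.Decidable using (yes; no; does)
open import Relation.Nullary.Negation using (¬_; contradiction)

-- Preliminaries: iterates and arithmetic in a field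

fold-cancel : ∀ {a} {A : Set a} {x : A} {f : A → A} → (∀ {y z} → f y ≡ f z → y ≡ z) →
              ∀ m {y} → fold x f m ≡ fold y f m → x ≡ y
fold-cancel inj zero    eq = eq
fold-cancel inj (suc m) eq = fold-cancel inj m (inj eq)

module HeytingFieldProperties {c ℓ₁ ℓ₂} (K : HeytingField c ℓ₁ ℓ₂) where
  open HeytingField K
  open CommutativeRing (HeytingCommutativeRing.commutativeRing heytingCommutativeRing)
    using (semiring; *-commutativeMonoid; +-group; ring) public
  open HCRProperties heytingCommutativeRing public
    using (1#0; x-0≈x; x#0y#0→xy#0; #-congʳ; invertibleˡ⇒#)
  open CommutativeMonoidSolver *-commutativeMonoid public using (solve; _⊕_; _⊜_)
  open SetoidReasoning setoid

  inverse : ∀ {x} (x#0 : x # 0#) → proj₁ (#⇒invertible x#0) * x ≈ 1#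
  inverse {x} x#0 =
    trans (*-congˡ (sym (x-0≈x x))) (proj₁ (proj₂ (#⇒invertible x#0)))

  *-cancelˡ-# : ∀ {x y z} → x # 0# → x * y ≈ x * z → y ≈ z
  *-cancelˡ-# {x} {y} {z} x#0 xy≈xz = begin
    y              ≈⟨ *-identityˡ y ⟨
    1# * y         ≈⟨ *-congʳ (inverse x#0) ⟨
    x⁻¹ * x * y    ≈⟨ *-assoc x⁻¹ x y ⟩
    x⁻¹ * (x * y)  ≈⟨ *-congˡ xy≈xz ⟩
    x⁻¹ * (x * z)  ≈⟨ *-assoc x⁻¹ x z ⟨
    x⁻¹ * x * z    ≈⟨ *-congʳ (inverse x#0) ⟩
    1# * z         ≈⟨ *-identityˡ z ⟩
    z              ∎
    where
    x⁻¹ = proj₁ (#⇒invertible x#0)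

  xy#0→x#0 : ∀ {x y} → x * y # 0# → x # 0#
  xy#0→x#0 {x} {y} xy#0 = invertibleˡ⇒# (z * y , (begin
    z * y * (x - 0#)  ≈⟨ *-congˡ (x-0≈x x) ⟩
    z * y * x         ≈⟨ *-assoc z y x ⟩
    z * (y * x)       ≈⟨ *-congˡ (*-comm y x) ⟩
    z * (x * y)       ≈⟨ inverse xy#0 ⟩
    1#                ∎))
    where
    z = proj₁ (#⇒invertible xy#0)

  xy#0→y#0 : ∀ {x y} → x * y # 0# → y # 0#
  xy#0→y#0 {x} {y} xy#0 = xy#0→x#0 (#-congʳ (*-comm x y) xy#0)

  0#0-absurd : ¬ (0# # 0#)
  0#0-absurd = #-irrefl refl

-- Cocycles along walks, and simulations up to coboundary

module DynamicsTheory {c ℓ₁ ℓ₂} (K : HeytingField c ℓ₁ ℓ₂) where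
  open HeytingField K
  open HeytingFieldProperties K
  open SetoidReasoning setoid

  record Dynamics : Set (lsuc 0ℓ ⊔ c) where
    field
      State   : Set
      step    : State → State
      num den : State → Carrier

    walk : State → ℕ → State
    walk x = fold x step

    along : (State → Carrier) → State → ℕ → Carrier
    along f x zero    = 1#
    along f x (suc n) = along f x n * f (walk x n)

    Balanced : Set ℓ₁
    Balanced = ∀ x n → walk x n ≡ x → along num x n ≈ along den x n

    along-+ : ∀ f x k m → along f x (k +ℕ m) ≈ along f x m * along f (walk x m) k
    along-+ f x zero    m = sym (*-identityʳ _)
    along-+ f x (suc k) m = begin
      along f x (k +ℕ m) * f (walk x (k +ℕ m))
        ≈⟨ *-cong (along-+ f x k m) (reflexive (≡.cong f (fold-+ x step k))) ⟩
      along f x m * along f (walk x m) k * f (walk (walk x m) k)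
        ≈⟨ *-assoc _ _ _ ⟩
      along f x m * (along f (walk x m) k * f (walk (walk x m) k)) ∎

    along-# : ∀ {f} → (∀ x → f x # 0#) → ∀ x n → along f x n # 0#
    along-# f#0 x zero    = 1#0
    along-# f#0 x (suc n) = x#0y#0→xy#0 (along-# f#0 x n) (f#0 _)

  invert : Dynamics → Dynamics
  invert D = record { State = State ; step = step ; num = den ; den = num }
    where open Dynamics D

  invert-balanced : ∀ D → Dynamics.Balanced D → Dynamics.Balanced (invert D)
  invert-balanced D bal x n closed = begin
    ID.along D.den x n  ≈⟨ same D.den n ⟩
    D.along D.den x n   ≈⟨ bal x n closed ⟨
    D.along D.num x n   ≈⟨ same D.num n ⟨
    ID.along D.num x n  ∎
    where
    module D = Dynamics D
    module ID = Dynamics (invert D)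
    -- The two `along` belong to different records and unfold only on a constructor, so their
    -- agreement takes an induction.
    same : ∀ f n → ID.along f x n ≈ D.along f x n
    same f zero    = refl
    same f (suc n) = *-congʳ (same f n)

  -- The factor num / den of each step of D is the product of these factors along
  -- a (possibly empty) walk of D′, up to a coboundary of the potential u / w.
  -- Denominators are cleared throughout.
  record Simulation (D D′ : Dynamics) : Set (c ⊔ ℓ₁ ⊔ ℓ₂) where
    private
      module D  = Dynamics D
      module D′ = Dynamics D′
    field
      π      : D.State → D′.State
      u w    : D.State → Carrier
      u#0    : ∀ x → u x # 0#
      w#0    : ∀ x → w x # 0#
      num′#0 : ∀ y → D′.num y # 0#
      lift   : ∀ x → ∃[ k ] π (D.step x) ≡ D′.walk (π x) k ×
        D.num x * D′.along D′.den (π x) k * (u (D.step x) * w x) ≈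
        D′.along D′.num (π x) k * D.den x * (u x * w (D.step x))

    -- The coboundaries telescope: the potentials `u y` and `w y` at the intermediate state `y` turn
    -- up on both sides when the two balances are multiplied, and are cancelled.
    lift-walk : ∀ x n → ∃[ k ] π (D.walk x n) ≡ D′.walk (π x) k ×
      D.along D.num x n * D′.along D′.den (π x) k * (u (D.walk x n) * w x) ≈
      D′.along D′.num (π x) k * D.along D.den x n * (u x * w (D.walk x n))
    lift-walk x zero    = 0 , ≡.refl , refl
    lift-walk x (suc n)
      with m , eq , balance ← lift-walk x n
      with k , eq′ , balance′ ← lift (D.walk x n)
      rewrite eq
      = k +ℕ m , ≡.trans eq′ (≡.sym (fold-+ (π x) D′.step k))
      , *-cancelˡ-# (x#0y#0→xy#0 (u#0 y) (w#0 y)) (begin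
          (u y * w y) * (N * D.num y * D′.along D′.den (π x) (k +ℕ m) * (u z * w x))
            ≈⟨ *-congˡ (*-congʳ (*-congˡ (D′.along-+ D′.den (π x) k m))) ⟩
          (u y * w y) * (N * D.num y * (Q * Q′) * (u z * w x))
            ≈⟨ solve 8 (λ uy wy N a Q Q′ uz wx →
                 (uy ⊕ wy) ⊕ (((N ⊕ a) ⊕ (Q ⊕ Q′)) ⊕ (uz ⊕ wx)) ⊜
                 ((N ⊕ Q) ⊕ (uy ⊕ wx)) ⊕ ((a ⊕ Q′) ⊕ (uz ⊕ wy)))
               refl (u y) (w y) N (D.num y) Q Q′ (u z) (w x) ⟩
          N * Q * (u y * w x) * (D.num y * Q′ * (u z * w y))
            ≈⟨ *-cong balance balance′ ⟩
          P * M * (u x * w y) * (P′ * D.den y * (u y * w z))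
            ≈⟨ solve 8 (λ uy wy M b P P′ ux wz →
                 ((P ⊕ M) ⊕ (ux ⊕ wy)) ⊕ ((P′ ⊕ b) ⊕ (uy ⊕ wz)) ⊜
                 (uy ⊕ wy) ⊕ (((P ⊕ P′) ⊕ (M ⊕ b)) ⊕ (ux ⊕ wz)))
               refl (u y) (w y) M (D.den y) P P′ (u x) (w z) ⟩
          (u y * w y) * (P * P′ * (M * D.den y) * (u x * w z))
            ≈⟨ *-congˡ (*-congʳ (*-congʳ (D′.along-+ D′.num (π x) k m))) ⟨
          (u y * w y) * (D′.along D′.num (π x) (k +ℕ m) * (M * D.den y) * (u x * w z)) ∎)
      where
      y = D.walk x n
      z = D.step y
      N = D.along D.num x n
      M = D.along D.den x n
      P = D′.along D′.num (π x) m
      Q = D′.along D′.den (π x) m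
      P′ = D′.along D′.num (D′.walk (π x) m) k
      Q′ = D′.along D′.den (D′.walk (π x) m) k

    -- The image under `π` of a closed walk is closed, so `bal` applies to it, and the potentials at
    -- the two equal ends cancel.
    balanced : D′.Balanced → D.Balanced
    balanced bal x n closed
      with k , eq , balance ← lift-walk x n
      rewrite closed
      = *-cancelˡ-# (x#0y#0→xy#0 (D′.along-# num′#0 (π x) k) (x#0y#0→xy#0 (u#0 x) (w#0 x)))
        (begin
          P * (u x * w x) * D.along D.num x n
            ≈⟨ *-congʳ (*-congʳ (bal (π x) k (≡.sym eq))) ⟩
          Q * (u x * w x) * D.along D.num x n
            ≈⟨ solve 3 (λ Q c N → (Q ⊕ c) ⊕ N ⊜ (N ⊕ Q) ⊕ c) refl Q (u x * w x) (D.along D.num x n) ⟩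
          D.along D.num x n * Q * (u x * w x)
            ≈⟨ balance ⟩
          P * D.along D.den x n * (u x * w x)
            ≈⟨ solve 3 (λ P c M → (P ⊕ M) ⊕ c ⊜ (P ⊕ c) ⊕ M) refl P (u x * w x) (D.along D.den x n) ⟩
          P * (u x * w x) * D.along D.den x n ∎)
      where
      P = D′.along D′.num (π x) k
      Q = D′.along D′.den (π x) k

-- Pairings and the choice of lifts

module TilingDynamics {c ℓ₁ ℓ₂} (K : HeytingField c ℓ₁ ℓ₂) (d : ℕ) where
  open HeytingField K
  open HeytingFieldProperties K
  open DynamicsTheory K
  open Tilings K d
  open Tiling
  open SetoidReasoning setoid hiding (start)
  private
    module ∑ = SemiringSum semiring
    module ∏ = CommutativeMonoidSum *-commutativeMonoid

  apply-cong : ∀ ℓ {x y} → (∀ j → x j ≈ y j) → apply ℓ x ≈ apply ℓ y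
  apply-cong ℓ x≈y = ∑.sum-cong-≋ (λ j → *-congˡ {vec ℓ j} (x≈y j))

  apply-+ : ∀ ℓ x y → apply ℓ (λ j → x j + y j) ≈ apply ℓ x + apply ℓ y
  apply-+ ℓ x y =
    trans (∑.sum-cong-≋ (λ j → distribˡ (vec ℓ j) (x j) (y j)))
          (∑.∑-distrib-+ (λ j → vec ℓ j * x j) (λ j → vec ℓ j * y j))

  apply-* : ∀ ℓ a x → apply ℓ (λ j → a * x j) ≈ a * apply ℓ x
  apply-* ℓ a x =
    trans (∑.sum-cong-≋ (λ j → solve 3 (λ l a x → l ⊕ (a ⊕ x) ⊜ a ⊕ (l ⊕ x)) refl (vec ℓ j) a (x j)))
          (sym (∑.*-distribˡ-sum a (λ j → vec ℓ j * x j)))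

  pair-comm : ∀ ℓ A → pair ℓ A ≈ pair A ℓ
  pair-comm ℓ A = ∑.sum-cong-≋ (λ j → *-comm (vec ℓ j) (vec A j))

  pair-scale : ∀ ℓ ℓ′ A A′ ((a , _) : ℓ ≈ₚ ℓ′) ((b , _) : A ≈ₚ A′) →
               pair ℓ A ≈ a * b * pair ℓ′ A′
  pair-scale ℓ ℓ′ A A′ (a , _ , ℓ≈) (b , _ , A≈) = begin
    pair ℓ A
      ≈⟨ ∑.sum-cong-≋ (λ j → trans (*-cong (ℓ≈ j) (A≈ j))
           (solve 4 (λ a l b x → (a ⊕ l) ⊕ (b ⊕ x) ⊜ (a ⊕ b) ⊕ (l ⊕ x)) refl a (vec ℓ′ j) b (vec A′ j))) ⟩
    ∑ (λ j → a * b * (vec ℓ′ j * vec A′ j))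
      ≈⟨ ∑.*-distribˡ-sum (a * b) (λ j → vec ℓ′ j * vec A′ j) ⟨
    a * b * pair ℓ′ A′ ∎

  ≈ₚ-sym : ∀ {P Q} → P ≈ₚ Q → Q ≈ₚ P
  ≈ₚ-sym {P} {Q} (a , a#0 , P≈aQ) = a⁻¹ , a⁻¹#0 , λ j → begin
    vec Q j               ≈⟨ *-identityˡ _ ⟨
    1# * vec Q j          ≈⟨ *-congʳ (inverse a#0) ⟨
    a⁻¹ * a * vec Q j     ≈⟨ *-assoc _ _ _ ⟩
    a⁻¹ * (a * vec Q j)   ≈⟨ *-congˡ (P≈aQ j) ⟨
    a⁻¹ * vec P j         ∎
    where
    a⁻¹ = proj₁ (#⇒invertible a#0)
    a⁻¹#0 : a⁻¹ # 0#
    a⁻¹#0 = xy#0→x#0 (#-congʳ (sym (inverse a#0)) 1#0)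

  -- The states are arbitrary because the comparison of two tilings passes through intermediate
  -- systems, with the rotations of one tiling and the labels of the other, or with additional
  -- states.
  labelled : (S : Set) → (S → S) → (P H : S → Proj) → Dynamics
  labelled S φ P H = record
    { State = S
    ; step  = φ
    ; num   = λ x → pair (H x) (P x)
    ; den   = λ x → pair (H x) (P (φ x))
    }

  -- The scalar `a x` of the hyperplane occurs in both the numerator and the denominator of a step,
  -- while the scalars of the points contribute `b x` over `b (φ x)`, the coboundary of `b`.
  relabel : ∀ {S S′ : Set} {φ : S → S} {φ′ : S′ → S′} {P H P′ H′} (f : S → S′) →
            (∀ x → f (φ x) ≡ φ′ (f x)) →
            (∀ x → P x ≈ₚ P′ (f x)) → (∀ x → H x ≈ₚ H′ (f x)) →
            (∀ y → pair (H′ y) (P′ y) # 0#) →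
            Simulation (labelled S φ P H) (labelled S′ φ′ P′ H′)
  relabel {φ = φ} {φ′} {P} {H} {P′} {H′} f f-step P≈ H≈ num#0 = record
    { π      = f
    ; u      = b
    ; w      = λ _ → 1#
    ; u#0    = λ x → proj₁ (proj₂ (P≈ x))
    ; w#0    = λ _ → 1#0
    ; num′#0 = num#0
    ; lift   = λ x → 1 , f-step x , (begin
        pair (H x) (P x) * (1# * q′ x) * (b (φ x) * 1#)
          ≈⟨ *-congʳ (*-congʳ (pair-scale (H x) (H′ (f x)) (P x) (P′ (f x)) (H≈ x) (P≈ x))) ⟩
        (a x * b x * p′ x) * (1# * q′ x) * (b (φ x) * 1#)
          ≈⟨ cocycle (a x) (b x) (p′ x) (q′ x) (b (φ x)) 1# ⟩
        (1# * p′ x) * (a x * b (φ x) * q′ x) * (b x * 1#)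
          ≈⟨ *-congʳ (*-congˡ (*-congˡ (reflexive
               (≡.cong (λ y → pair (H′ (f x)) (P′ y)) (≡.sym (f-step x)))))) ⟩
        (1# * p′ x) * (a x * b (φ x) * pair (H′ (f x)) (P′ (f (φ x)))) * (b x * 1#)
          ≈⟨ *-congʳ (*-congˡ (pair-scale (H x) (H′ (f x)) (P (φ x)) (P′ (f (φ x))) (H≈ x) (P≈ (φ x)))) ⟨
        (1# * p′ x) * pair (H x) (P (φ x)) * (b x * 1#) ∎)
    }
    where
    a b p′ q′ : _ → Carrier
    a x  = proj₁ (H≈ x)
    b x  = proj₁ (P≈ x)
    p′ x = pair (H′ (f x)) (P′ (f x))
    q′ x = pair (H′ (f x)) (P′ (φ′ (f x)))
    cocycle = solve 6 (λ a b p q b′ e →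
      (((a ⊕ b) ⊕ p) ⊕ (e ⊕ q)) ⊕ (b′ ⊕ e) ⊜ ((e ⊕ p) ⊕ ((a ⊕ b′) ⊕ q)) ⊕ (b ⊕ e)) refl

  -- Coherence of faces as balance of closed walks

  dynamics : Tiling → Dynamics
  dynamics T = labelled (Edge T) (φ T) (pointAt T) (hyperplaneAt T)

  module _ (T : Tiling) where
    open Dynamics (dynamics T) using (num; den; walk; along; along-+; Balanced)
    open BipartiteMap.Face

    pointAt-σ∘ : ∀ e → pointAt T (σ∘ T e) ≡ pointAt T e
    pointAt-σ∘ e = ≡.cong (point T) (≡.sym (Equivalence.from (white-orbit T e _) (1 , ≡.refl)))

    hyperplaneAt-σ• : ∀ e → hyperplaneAt T (σ• T e) ≡ hyperplaneAt T e
    hyperplaneAt-σ• e = ≡.cong (hyperplane T) (≡.sym (Equivalence.from (black-orbit T e _) (1 , ≡.refl)))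

    -- The next white vertex is reached along `σ• e`, so denominators too are pairings along edges.
    den≡num-σ• : ∀ e → den e ≡ num (σ• T e)
    den≡num-σ• e = ≡.cong₂ pair (≡.sym (hyperplaneAt-σ• e)) (pointAt-σ∘ (σ• T e))

    σ∘-injective : ∀ {e f} → σ∘ T e ≡ σ∘ T f → e ≡ f
    σ∘-injective eq = ≡.trans (≡.sym (inverseˡ (rot∘ T)))
                        (≡.trans (≡.cong (rot∘ T ⟨$⟩ˡ_) eq) (inverseˡ (rot∘ T)))

    σ•-injective : ∀ {e f} → σ• T e ≡ σ• T f → e ≡ f
    σ•-injective eq = ≡.trans (≡.sym (inverseˡ (rot• T)))
                        (≡.trans (≡.cong (rot• T ⟨$⟩ˡ_) eq) (inverseˡ (rot• T)))

    -- Among the first `#edges + 1` iterates two coincide, and injectivity of `φ` cancels the common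
    -- initial part.
    periodic : ∀ e → ∃[ n ] walk e (suc n) ≡ e
    periodic e with i , j , i<j , eq ← pigeonhole (ℕ.n<1+n (#edges T)) (λ i → walk e (toℕ i))
      = k , ≡.sym (fold-cancel (σ•-injective ∘ σ∘-injective) (toℕ i) (≡.trans eq
          (≡.trans (≡.cong (walk e) (≡.sym j≡i+1+k)) (fold-+ e (φ T) (toℕ i)))))
      where
      k = proj₁ (ℕ.m≤n⇒∃[o]m+o≡n i<j)
      j≡i+1+k : toℕ i +ℕ suc k ≡ toℕ j
      j≡i+1+k = ≡.trans (ℕ.+-suc (toℕ i) k) (proj₂ (ℕ.m≤n⇒∃[o]m+o≡n i<j))

    ∏-along : ∀ f e n → ∏ {n} (λ i → f (walk e (toℕ i))) ≈ along f e n
    ∏-along f e zero    = refl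
    ∏-along f e (suc n) = begin
      ∏ {suc n} (λ i → f (walk e (toℕ i)))
        ≈⟨ ∏.sum-init-last {n} (λ i → f (walk e (toℕ i))) ⟩
      ∏ {n} (λ i → f (walk e (toℕ (inject₁ i)))) * f (walk e (toℕ (fromℕ n)))
        ≈⟨ *-cong (reflexive (∏.sum-cong-≗ {n} (λ i → ≡.cong (f ∘ walk e) (toℕ-inject₁ i))))
                  (reflexive (≡.cong (f ∘ walk e) (toℕ-fromℕ n))) ⟩
      ∏ {n} (λ i → f (walk e (toℕ i))) * f (walk e n)
        ≈⟨ *-congʳ (∏-along f e n) ⟩
      along f e n * f (walk e n) ∎

    walk-next : ∀ e n → walk e (suc n) ≡ e → (i : Fin (suc n)) →
                walk e (toℕ (next i)) ≡ walk e (suc (toℕ i))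
    walk-next e n closed i with ℕ.m≤n⇒m<n∨m≡n (toℕ<n i)
    ... | inj₁ i+1<n+1 = ≡.cong (walk e) (≡.trans (toℕ-fromℕ< _) (m<n⇒m%n≡m i+1<n+1))
    ... | inj₂ i+1≡n+1 = ≡.trans (≡.cong (walk e) toℕ-next≡0)
                           (≡.trans (≡.sym closed) (≡.cong (walk e) (≡.sym i+1≡n+1)))
      where
      toℕ-next≡0 : toℕ (next i) ≡ 0
      toℕ-next≡0 = ≡.trans (toℕ-fromℕ< (m%n<n (suc (toℕ i)) (suc n)))
                     (≡.trans (≡.cong (_% suc n) i+1≡n+1) (n%n≡0 (suc n)))

    module _ (F : Face T) where
      private
        n  = suc (n-1 F)
        A  = λ i → pointAt T (edgeAt F i)
        ℓ  = λ i → hyperplaneAt T (edgeAt F i)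

      numerator-along : numerator A ℓ ≈ along num (start F) n
      numerator-along = ∏-along num (start F) n

      denominator-along : denominator A ℓ ≈ along den (start F) n
      denominator-along = trans
        (reflexive (∏.sum-cong-≗ (λ i → ≡.cong (λ e → pair (ℓ i) (pointAt T e))
          (walk-next (start F) (n-1 F) (closed F) i))))
        (∏-along den (start F) n)

      -- The denominator is invertible as part of coherence. Since the ratio is 1, so is the
      -- numerator; this is the source of the nonzero pairings of a coherent tiling.
      coherentFace⇒balanced : CoherentFace T F →
        along num (start F) n ≈ along den (start F) n × along num (start F) n # 0#
      coherentFace⇒balanced (den#0 , ratio≈1) = N≈M , #-congʳ (sym N≈M) (#-congʳ denominator-along den#0)
        where
        D = denominator A ℓ
        D⁻¹ = proj₁ (#⇒invertible den#0)
        N≈M : along num (start F) n ≈ along den (start F) n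
        N≈M = begin
          along num (start F) n     ≈⟨ numerator-along ⟨
          numerator A ℓ             ≈⟨ *-identityʳ _ ⟨
          numerator A ℓ * 1#        ≈⟨ *-congˡ (inverse den#0) ⟨
          numerator A ℓ * (D⁻¹ * D) ≈⟨ *-assoc _ _ _ ⟨
          numerator A ℓ * D⁻¹ * D   ≈⟨ *-congʳ ratio≈1 ⟩
          1# * D                    ≈⟨ *-identityˡ _ ⟩
          D                         ≈⟨ denominator-along ⟩
          along den (start F) n     ∎

      balanced⇒coherentFace : Balanced → NonzeroPairings T → CoherentFace T F
      balanced⇒coherentFace bal nz = D#0 , (begin
        numerator A ℓ * D⁻¹        ≈⟨ *-congʳ (trans numerator-along (trans (bal (start F) n (closed F)) (sym denominator-along))) ⟩
        denominator A ℓ * D⁻¹      ≈⟨ *-comm _ _ ⟩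
        D⁻¹ * denominator A ℓ      ≈⟨ inverse D#0 ⟩
        1#                         ∎)
        where
        D#0 : denominator A ℓ # 0#
        D#0 = #-congʳ (sym denominator-along) (Dynamics.along-# (dynamics T)
          (λ e → #-congʳ (reflexive (≡.sym (den≡num-σ• e))) (nz (σ• T e))) (start F) n)
        D⁻¹ = proj₁ (#⇒invertible D#0)

    module _ (coherent : Coherent T) where

      -- A closed walk is a face if its length is minimal, and otherwise the
      -- concatenation of two shorter closed walks.
      closed-walk : ∀ e n → walk e (suc n) ≡ e →
                    along num e (suc n) ≈ along den e (suc n) × num e # 0#
      closed-walk e = <-rec _ λ n rec closed → go n rec closed
        where
        Q = λ n → along num e (suc n) ≈ along den e (suc n) × num e # 0#
        -- `num e` is the innermost factor of the product, reached by dropping the later ones.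
        head#0 : ∀ n → along num e (suc n) # 0# → num e # 0#
        head#0 zero    h = xy#0→y#0 h
        head#0 (suc n) h = head#0 n (xy#0→x#0 h)
        go : ∀ n → (∀ {m} → m < n → walk e (suc m) ≡ e → Q m) → walk e (suc n) ≡ e → Q n
        go n rec closed with ℕ.anyUpTo? (λ k → walk e (suc k) ≟ e) n
        ... | no none = proj₁ balanced , head#0 n (proj₂ balanced)
          where
          F : Face T
          F = record
            { start   = e
            ; n-1     = n
            ; closed  = closed
            ; minimal = λ { (suc k) _ k<n back → none (k , ℕ.≤-pred k<n , back) }
            }
          balanced = coherentFace⇒balanced F (coherent F)
        -- The walk is back at `e` after `suc m` of its `suc n` steps; the other `suc o` steps form
        -- a closed walk from `e` as well.
        ... | yes (m , m<n , back)
          with o , ≡.refl ← ℕ.m≤n⇒∃[o]m+o≡n m<n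
          = ≡.subst (λ l → along num e l ≈ along den e l) length (begin
              along num e (suc o +ℕ suc m)                     ≈⟨ along-+ num e (suc o) (suc m) ⟩
              along num e (suc m) * along num (walk e (suc m)) (suc o)
                ≈⟨ *-congˡ (reflexive (≡.cong (λ x → along num x (suc o)) back)) ⟩
              along num e (suc m) * along num e (suc o)        ≈⟨ *-cong (proj₁ Qm) (proj₁ Qo) ⟩
              along den e (suc m) * along den e (suc o)
                ≈⟨ *-congˡ (reflexive (≡.cong (λ x → along den x (suc o)) back)) ⟨
              along den e (suc m) * along den (walk e (suc m)) (suc o) ≈⟨ along-+ den e (suc o) (suc m) ⟨
              along den e (suc o +ℕ suc m)                     ∎)
          , proj₂ Qm
          where
          length : suc o +ℕ suc m ≡ suc (suc m +ℕ o)
          length = ≡.cong suc (ℕ.+-comm o (suc m))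
          Qm = rec m<n back
          back′ : walk e (suc o) ≡ e
          back′ = ≡.trans (≡.cong (λ x → walk x (suc o)) (≡.sym back))
                    (≡.trans (≡.sym (fold-+ e (φ T) (suc o)))
                      (≡.trans (≡.cong (walk e) length) closed))
          Qo = rec (s≤s (ℕ.m≤n+m o m)) back′

      coherent⇒balanced : Balanced
      coherent⇒balanced e zero    _      = refl
      coherent⇒balanced e (suc n) closed = proj₁ (closed-walk e n closed)

      coherent⇒nonzeroPairings : NonzeroPairings T
      coherent⇒nonzeroPairings e with n , closed ← periodic e = proj₂ (closed-walk e n closed)

  -- Exchange of colors

  -- `σ∘` conjugates the step `σ• ∘ σ∘` of the swapped tiling to `φ`. Numerators and denominators
  -- trade places, hence `invert`, but one of the two is shifted by a step; the pairing along the
  -- edge, as potential, absorbs the shift.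
  swapColors-simulation : ∀ T → NonzeroPairings T →
                          Simulation (dynamics (swapColors T)) (invert (dynamics T))
  swapColors-simulation T nz = record
    { π      = σ∘ T
    ; u      = S.num
    ; w      = λ _ → 1#
    ; u#0    = λ e → #-congʳ (pair-comm (hyperplaneAt T e) (pointAt T e)) (nz e)
    ; w#0    = λ _ → 1#0
    ; num′#0 = λ e → #-congʳ (reflexive (≡.sym (den≡num-σ• T e))) (nz (σ• T e))
    ; lift   = λ e → 1 , ≡.refl , (begin
        S.num e * (1# * D.num (σ∘ T e)) * (S.num (S.step e) * 1#)
          ≈⟨ *-congʳ (*-congˡ (*-congˡ (num-σ∘ e))) ⟩
        S.num e * (1# * S.den e) * (S.num (S.step e) * 1#)
          ≈⟨ solve 4 (λ p q p′ i → (p ⊕ (i ⊕ q)) ⊕ (p′ ⊕ i) ⊜ ((i ⊕ p′) ⊕ q) ⊕ (p ⊕ i))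
               refl (S.num e) (S.den e) (S.num (S.step e)) 1# ⟩
        1# * S.num (S.step e) * S.den e * (S.num e * 1#)
          ≈⟨ *-congʳ (*-congʳ (*-congˡ (den-σ∘ e))) ⟨
        1# * D.den (σ∘ T e) * S.den e * (S.num e * 1#) ∎)
    }
    where
    module D = Dynamics (dynamics T)
    module S = Dynamics (dynamics (swapColors T))
    num-σ∘ : ∀ e → D.num (σ∘ T e) ≈ S.den e
    num-σ∘ e = trans
      (reflexive (≡.cong₂ pair (≡.sym (hyperplaneAt-σ• T (σ∘ T e))) (pointAt-σ∘ T e)))
      (pair-comm (hyperplaneAt T (S.step e)) (pointAt T e))
    den-σ∘ : ∀ e → D.den (σ∘ T e) ≈ S.num (S.step e)
    den-σ∘ e = trans (reflexive (den≡num-σ• T (σ∘ T e)))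
      (pair-comm (hyperplaneAt T (S.step e)) (pointAt T (S.step e)))

  NonzeroPairings-swapColors : ∀ T → NonzeroPairings T → NonzeroPairings (swapColors T)
  NonzeroPairings-swapColors T nz e =
    #-congʳ (pair-comm (hyperplaneAt T e) (pointAt T e)) (nz e)

  DoubleCircuit-swapColors : ∀ T → DoubleCircuit T → DoubleCircuit (swapColors T)
  DoubleCircuit-swapColors T (dc∘ , dc•) = dc• , dc∘

  Balanced : Tiling → Set ℓ₁
  Balanced T = Dynamics.Balanced (dynamics T)

  Balanced-swapColors : ∀ T → NonzeroPairings T → Balanced T → Balanced (swapColors T)
  Balanced-swapColors T nz bal = Simulation.balanced (swapColors-simulation T nz)
    (invert-balanced (dynamics T) bal)

  -- Linear dependencies at a vertex

  sum-agree : ∀ {n} (f g : Fin n → Carrier) k → ∑ f ≈ ∑ g →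
              (∀ i → i ≢ k → f i ≈ g i) → f k ≈ g k
  sum-agree {suc n} f g k ∑f≈∑g f≈g =
    GroupProperties.∙-cancelʳ +-group (∑ (removeAt g k)) (f k) (g k) (begin
      f k + ∑ (removeAt g k)  ≈⟨ +-congˡ (∑.sum-cong-≋ {n} (λ j → f≈g _ (punchInᵢ≢i k j))) ⟨
      f k + ∑ (removeAt f k)  ≈⟨ ∑.sum-remove {i = k} f ⟨
      ∑ f                     ≈⟨ ∑f≈∑g ⟩
      ∑ g                     ≈⟨ ∑.sum-remove {i = k} g ⟩
      g k + ∑ (removeAt g k)  ∎)

  ∑-zero : ∀ n → ∑ {n} (λ _ → 0#) ≈ 0#
  ∑-zero n = ∑.sum-replicate-zero n

  ∑-apply : ∀ {n} (a : Fin n → Carrier) (H : Fin n → Hyperplane) →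
            (∀ j → combination a H j ≈ 0#) → ∀ x → ∑ (λ i → a i * apply (H i) x) ≈ 0#
  ∑-apply {n} a H dep x = begin
    ∑ (λ i → a i * apply (H i) x)
      ≈⟨ ∑.sum-cong-≋ {n} (λ i → ∑.*-distribˡ-sum (a i) (λ j → vec (H i) j * x j)) ⟩
    ∑ (λ i → ∑ (λ j → a i * (vec (H i) j * x j)))
      ≈⟨ ∑.∑-comm (λ i j → a i * (vec (H i) j * x j)) ⟩
    ∑ (λ j → ∑ (λ i → a i * (vec (H i) j * x j)))
      ≈⟨ ∑.sum-cong-≋ (λ j → trans
           (∑.sum-cong-≋ {n} (λ i → sym (*-assoc (a i) (vec (H i) j) (x j))))
           (trans (sym (∑.*-distribʳ-sum {n} (x j) (λ i → a i * vec (H i) j)))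
                  (trans (*-congʳ (dep j)) (zeroˡ (x j))))) ⟩
    ∑ {suc d} (λ j → 0#)
      ≈⟨ ∑-zero (suc d) ⟩
    0# ∎

  module WhiteVertex (T : Tiling) (dc : DoubleCircuit T) (v : White T) where
    private
      dependent = proj₁ (proj₁ dc v)

    coeff : Edge T → Carrier
    coeff = proj₁ dependent

    coeff-support : ∀ {e} → white T e ≢ v → coeff e ≈ 0#
    coeff-support {e} e≁v = proj₁ (proj₂ dependent) e (λ e∈ → absurd
      (≡.trans (≡.sym (lookup∘tabulate (λ e → does (white T e ≟ v)) e)) ([]=⇒lookup e∈)))
      where
      absurd : ¬ (does (white T e ≟ v) ≡ true)
      absurd eq with white T e ≟ v
      ... | yes e∼v = e≁v e∼v
      absurd () | no _

    -- The coefficients vanish off the star of `v`, so a nonzero one belongs to an edge at `v`.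
    coeff-nonzero : ∃[ e ] white T e ≡ v × coeff e # 0#
    coeff-nonzero with e , a#0 ← proj₁ (proj₂ (proj₂ dependent)) with white T e ≟ v
    ... | yes e∼v = e , e∼v , a#0
    ... | no  e≁v = contradiction (#-congʳ (coeff-support e≁v) a#0) 0#0-absurd

    coeff-dependency : ∀ j → combination coeff (hyperplaneAt T) j ≈ 0#
    coeff-dependency = proj₂ (proj₂ (proj₂ dependent))

  -- At a vertex of degree one the dependency would have a single term, a nonzero multiple of a
  -- nonzero covector.
  σ∘-moves : ∀ T → DoubleCircuit T → ∀ e → σ∘ T e ≢ e
  σ∘-moves T dc e fixed
    with f , f∼e , a#0 ← WhiteVertex.coeff-nonzero T dc (white T e)
    with j , H#0 ← nonzero (hyperplaneAt T f)
    = contradiction (#-congʳ a*H≈0 (x#0y#0→xy#0 a#0 H#0)) 0#0-absurd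
    where
    open WhiteVertex T dc (white T e)
    alone : ∀ i → white T i ≡ white T e → e ≡ i
    alone i i∼e with k , eq ← Equivalence.to (white-orbit T e i) (≡.sym i∼e)
      = ≡.trans (≡.sym (stay k)) eq
      where
      stay : ∀ k → fold e (σ∘ T) k ≡ e
      stay zero    = ≡.refl
      stay (suc k) = ≡.trans (≡.cong (σ∘ T) (stay k)) fixed
    a*H≈0 : coeff f * vec (hyperplaneAt T f) j ≈ 0#
    a*H≈0 = sum-agree (λ i → coeff i * vec (hyperplaneAt T i) j) (λ _ → 0#) f
      (trans (coeff-dependency j) (sym (∑-zero (#edges T))))
      (λ i i≢f → trans (*-congʳ (coeff-support (λ i∼e →
        i≢f (≡.trans (≡.sym (alone i i∼e)) (alone f f∼e))))) (zeroˡ _))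

  -- Equality of points of the dual space, put as an exchange of arguments and not through a scalar;
  -- it is applied to multi-ratios in this form.
  Proportional : Hyperplane → Hyperplane → Set (c ⊔ ℓ₁)
  Proportional h k = ∀ x y → apply h x * apply k y ≈ apply h y * apply k x

  Proportional-sym : ∀ {h k} → Proportional h k → Proportional k h
  Proportional-sym h∥k x y = trans (*-comm _ _) (trans (h∥k y x) (*-comm _ _))

  -- The dependency is evaluated at `x` and multiplied by the value at `y` of one of the two
  -- covectors. The term of that covector is symmetric in `x` and `y`, so the other term is too, and
  -- its coefficient is cancelled. Either coefficient may be the one known to be nonzero, whence the
  -- two cases of `conclude`.
  degree-2⇒proportional : ∀ T → DoubleCircuit T → ∀ {e₁ e₂} →
    σ∘ T e₁ ≡ e₂ → σ∘ T e₂ ≡ e₁ → Proportional (hyperplaneAt T e₁) (hyperplaneAt T e₂)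
  degree-2⇒proportional T dc {e₁} {e₂} σe₁ σe₂
    with e , e∼e₁ , a#0 ← WhiteVertex.coeff-nonzero T dc (white T e₁)
    = conclude (ends e e∼e₁) a#0
    where
    open WhiteVertex T dc (white T e₁)
    ends : ∀ i → white T i ≡ white T e₁ → i ≡ e₁ ⊎ i ≡ e₂
    ends i i∼e₁ with k , eq ← Equivalence.to (white-orbit T e₁ i) (≡.sym i∼e₁)
      = ≡.subst (λ i → i ≡ e₁ ⊎ i ≡ e₂) eq (alternate k)
      where
      alternate : ∀ k → fold e₁ (σ∘ T) k ≡ e₁ ⊎ fold e₁ (σ∘ T) k ≡ e₂
      alternate zero = inj₁ ≡.refl
      alternate (suc k) with alternate k
      ... | inj₁ eq = inj₂ (≡.trans (≡.cong (σ∘ T) eq) σe₁)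
      ... | inj₂ eq = inj₁ (≡.trans (≡.cong (σ∘ T) eq) σe₂)
    H : Edge T → Hyperplane
    H = hyperplaneAt T
    a = coeff
    module _ {e e′} (a#0 : a e # 0#) (rest : ∀ i → i ≢ e → a i ≈ 0# ⊎ i ≡ e′) where
      proportional : Proportional (H e) (H e′)
      proportional x y = *-cancelˡ-# a#0 (sum-agree (term x y) (term y x) e
        (trans (∑-term x y) (sym (∑-term y x))) agree)
        where
        term : Vector → Vector → Edge T → Carrier
        term x y i = a i * (apply (H i) x * apply (H e′) y)
        ∑-term : ∀ x y → ∑ (term x y) ≈ 0#
        ∑-term x y = begin
          ∑ (term x y)
            ≈⟨ ∑.sum-cong-≋ {#edges T} (λ i → sym (*-assoc (a i) (apply (H i) x) (apply (H e′) y))) ⟩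
          ∑ (λ i → a i * apply (H i) x * apply (H e′) y)
            ≈⟨ ∑.*-distribʳ-sum (apply (H e′) y) (λ i → a i * apply (H i) x) ⟨
          ∑ (λ i → a i * apply (H i) x) * apply (H e′) y
            ≈⟨ *-congʳ (∑-apply a H coeff-dependency x) ⟩
          0# * apply (H e′) y
            ≈⟨ zeroˡ _ ⟩
          0# ∎
        agree : ∀ i → i ≢ e → term x y i ≈ term y x i
        agree i i≢e with rest i i≢e
        ... | inj₁ a≈0    = trans (*-congʳ a≈0) (trans (zeroˡ _) (sym (trans (*-congʳ a≈0) (zeroˡ _))))
        ... | inj₂ ≡.refl = *-congˡ (*-comm _ _)
    rest : ∀ i → a i ≈ 0# ⊎ (i ≡ e₁ ⊎ i ≡ e₂)
    rest i with white T i ≟ white T e₁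
    ... | yes i∼e₁ = inj₂ (ends i i∼e₁)
    ... | no  i≁e₁ = inj₁ (coeff-support i≁e₁)
    conclude : ∀ {e} → e ≡ e₁ ⊎ e ≡ e₂ → a e # 0# → Proportional (H e₁) (H e₂)
    conclude (inj₁ ≡.refl) a#0 = proportional a#0 others
      where
      others : ∀ i → i ≢ e₁ → a i ≈ 0# ⊎ i ≡ e₂
      others i i≢e₁ with rest i
      ... | inj₁ a≈0         = inj₁ a≈0
      ... | inj₂ (inj₁ i≡e₁) = contradiction i≡e₁ i≢e₁
      ... | inj₂ (inj₂ i≡e₂) = inj₂ i≡e₂
    conclude (inj₂ ≡.refl) a#0 = Proportional-sym {H e₂} {H e₁} (proportional a#0 others)
      where
      others : ∀ i → i ≢ e₂ → a i ≈ 0# ⊎ i ≡ e₁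
      others i i≢e₂ with rest i
      ... | inj₁ a≈0         = inj₁ a≈0
      ... | inj₂ (inj₁ i≡e₁) = inj₂ i≡e₁
      ... | inj₂ (inj₂ i≡e₂) = contradiction i≡e₂ i≢e₂

  -- Removal and addition of a vertex of degree two

  module Removal {T T′} (R : WhiteRemoval T T′) (dc : DoubleCircuit T) (nz : NonzeroPairings T) where
    open WhiteRemoval R
    private
      module D = Dynamics (dynamics T)

    H : Edge T → Hyperplane
    H = hyperplaneAt T

    P : Edge T → Point
    P = pointAt T

    -- The faces of `T′` with the lifts of `T`: the change of lifts is left to `relabel`.
    oldLabels : Dynamics
    oldLabels = labelled (Edge T′) (φ T′) (P ∘ ι) (H ∘ ι)

    oldLabels#0 : ∀ e → pair (H (ι e)) (P (ι e)) # 0#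
    oldLabels#0 e = nz (ι e)

    data Twins : Edge T → Edge T → Set where
      e₁e₂ : Twins e₁ e₂
      e₂e₁ : Twins e₂ e₁

    twins-σ∘ : ∀ {x y} → Twins x y → σ∘ T x ≡ y
    twins-σ∘ e₁e₂ = proj₁ degree-2
    twins-σ∘ e₂e₁ = proj₂ degree-2

    twins-sym : ∀ {x y} → Twins x y → Twins y x
    twins-sym e₁e₂ = e₂e₁
    twins-sym e₂e₁ = e₁e₂

    twins-proportional : ∀ {x y} → Twins x y → Proportional (H x) (H y)
    twins-proportional t = degree-2⇒proportional T dc (twins-σ∘ t) (twins-σ∘ (twins-sym t))

    twins-black : ∀ {x y} → Twins x y → black T x ≢ black T y
    twins-black e₁e₂ = ends
    twins-black e₂e₁ = ends ∘ ≡.sym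

    ι-not-twin : ∀ {s x y} → Twins x y → ι s ≢ x
    ι-not-twin e₁e₂ eq = proj₁ (Equivalence.to (ι-image _) (_ , eq)) ≡.refl
    ι-not-twin e₂e₁ eq = proj₂ (Equivalence.to (ι-image _) (_ , eq)) ≡.refl

    twin? : ∀ e → (∃[ y ] Twins e y) ⊎ (∃[ s ] ι s ≡ e)
    twin? e with e ≟ e₁ | e ≟ e₂
    ... | yes ≡.refl | _          = inj₁ (e₂ , e₁e₂)
    ... | no _       | yes ≡.refl = inj₁ (e₁ , e₂e₁)
    ... | no e≢e₁    | no e≢e₂    = inj₂ (Equivalence.from (ι-image e) (e≢e₁ , e≢e₂))

    skip-twin : ∀ e → (∃[ y ] Twins e y × skip e ≡ σ• T y) ⊎ skip e ≡ e
    skip-twin e with e ≟ e₁ | e ≟ e₂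
    ... | yes ≡.refl | _          = inj₁ (e₂ , e₁e₂ , ≡.refl)
    ... | no _       | yes ≡.refl = inj₁ (e₁ , e₂e₁ , ≡.refl)
    ... | no _       | no _       = inj₂ ≡.refl

    -- A detour arises when the rotation at the black end of `ι s` reaches a removed edge `x`. In
    -- `T` the walk then passes through the vertex of degree two and continues along `y`; in `T′` it
    -- makes one step around the merged vertex.
    data Step (s : Edge T′) : Set (c ⊔ ℓ₁) where
      direct : ι (φ T′ s) ≡ φ T (ι s) → Step s
      detour : ∀ {x y} → Twins x y → φ T (ι s) ≡ y → ι (φ T′ s) ≡ φ T y →
               Proportional (H (ι s)) (H y) → Step s

    classify : ∀ s → Step s
    classify s with skip-twin (σ• T (ι s))
    ... | inj₂ eq = direct (≡.trans (rotation∘ (σ• T′ s))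
                      (≡.cong (σ∘ T) (≡.trans (rotation• s) eq)))
    ... | inj₁ (y , t , eq) = detour t (twins-σ∘ t)
                      (≡.trans (rotation∘ (σ• T′ s)) (≡.cong (σ∘ T) (≡.trans (rotation• s) eq)))
                      (≡.subst (λ h → Proportional h (H y)) (hyperplaneAt-σ• T (ι s)) (twins-proportional t))

    oldLabels⇒T : Simulation oldLabels (dynamics T)
    oldLabels⇒T = record
      { π      = ι
      ; u      = λ _ → 1#
      ; w      = λ _ → 1#
      ; u#0    = λ _ → 1#0
      ; w#0    = λ _ → 1#0
      ; num′#0 = nz
      ; lift   = lift
      }
      where
      module O = Dynamics oldLabels
      lift : ∀ s → ∃[ k ] ι (φ T′ s) ≡ D.walk (ι s) k ×
        O.num s * D.along D.den (ι s) k * (1# * 1#) ≈ D.along D.num (ι s) k * O.den s * (1# * 1#)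
      lift s with classify s
      ... | direct eq = 1 , eq , *-congʳ (begin
        O.num s * (1# * D.den (ι s))
          ≈⟨ solve 3 (λ p e q → p ⊕ (e ⊕ q) ⊜ (e ⊕ p) ⊕ q) refl (O.num s) 1# (D.den (ι s)) ⟩
        1# * O.num s * D.den (ι s)
          ≈⟨ *-congˡ (reflexive (≡.cong (λ e → pair (H (ι s)) (P e)) eq)) ⟨
        1# * O.num s * O.den s ∎)
      ... | detour {y = y} t φ≡y eq h∥k =
        2 , ≡.trans eq (≡.cong (φ T) (≡.sym φ≡y)) , *-congʳ (begin
        O.num s * (1# * D.den (ι s) * D.den (φ T (ι s)))
          ≈⟨ *-congˡ (*-cong (*-congˡ (reflexive (≡.cong (λ e → pair (H (ι s)) (P e)) φ≡y)))
                             (reflexive (≡.cong D.den φ≡y))) ⟩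
        O.num s * (1# * pair (H (ι s)) (P y) * D.den y)
          ≈⟨ *-congˡ (*-assoc 1# (pair (H (ι s)) (P y)) (D.den y)) ⟩
        O.num s * (1# * (pair (H (ι s)) (P y) * D.den y))
          ≈⟨ *-congˡ (*-congˡ (h∥k (vec (P y)) (vec (P (φ T y))))) ⟩
        O.num s * (1# * (pair (H (ι s)) (P (φ T y)) * D.num y))
          ≈⟨ solve 4 (λ p e q r → p ⊕ (e ⊕ (q ⊕ r)) ⊜ ((e ⊕ p) ⊕ r) ⊕ q) refl
               (O.num s) 1# (pair (H (ι s)) (P (φ T y))) (D.num y) ⟩
        1# * O.num s * D.num y * pair (H (ι s)) (P (φ T y))
          ≈⟨ *-cong (*-congˡ (reflexive (≡.cong D.num φ≡y)))
                    (reflexive (≡.cong (λ e → pair (H (ι s)) (P e)) eq)) ⟨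
        1# * O.num s * D.num (φ T (ι s)) * O.den s ∎)

    -- A removed edge is contracted onto its successor along the face, and its whole factor `num e`
    -- over `den e` becomes the potential.
    data Location (e : Edge T) : Set where
      surviving : ∀ s → ι s ≡ e → Location e
      removed   : ∀ {y} s → Twins e y → ι s ≡ φ T e → Location e

    target u w : ∀ {e} → Location e → _
    target (surviving s _)   = s
    target (removed   s _ _) = s
    u {e} (surviving _ _)    = 1#
    u {e} (removed _ _ _)    = D.num e
    w {e} (surviving _ _)    = 1#
    w {e} (removed _ _ _)    = D.den e

    -- If `φ T x` were `x`, then `σ• T x` would be `y`, although `x` and `y` have different black
    -- ends; if it were `y`, then `σ•` would fix `x`, although no vertex has degree one.
    twin-successor-survives : ∀ {x y z} → Twins x y → ¬ Twins (φ T x) z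
    twin-successor-survives {x} {y} {z} t t′ =
      compare t t′ ≡.refl (twins-σ∘ t) (twins-σ∘ (twins-sym t))
      where
      moves : σ• T x ≢ x
      moves = σ∘-moves (swapColors T) (DoubleCircuit-swapColors T dc) x
      not-twin : σ• T x ≢ y
      not-twin eq = twins-black t (≡.trans (Equivalence.from (black-orbit T x _) (1 , ≡.refl)) (≡.cong (black T) eq))
      compare : ∀ {x′} → Twins x y → Twins x′ z → x′ ≡ φ T x → σ∘ T x ≡ y → σ∘ T y ≡ x → _
      compare e₁e₂ e₁e₂ eq σx σy = not-twin (σ∘-injective T (≡.trans (≡.sym eq) (≡.sym σy)))
      compare e₁e₂ e₂e₁ eq σx σy = moves (σ∘-injective T (≡.trans (≡.sym eq) (≡.sym σx)))
      compare e₂e₁ e₁e₂ eq σx σy = moves (σ∘-injective T (≡.trans (≡.sym eq) (≡.sym σx)))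
      compare e₂e₁ e₂e₁ eq σx σy = not-twin (σ∘-injective T (≡.trans (≡.sym eq) (≡.sym σy)))

    locate : ∀ e → Location e
    locate e with twin? e
    ... | inj₂ (s , ιs≡e) = surviving s ιs≡e
    ... | inj₁ (y , t) with twin? (φ T e)
    ...   | inj₂ (s , ιs≡φe) = removed s t ιs≡φe
    ...   | inj₁ (z , t′)    = contradiction t′ (twin-successor-survives t)

    T⇒oldLabels : Simulation (dynamics T) oldLabels
    T⇒oldLabels = record
      { π      = λ e → target (locate e)
      ; u      = λ e → u (locate e)
      ; w      = λ e → w (locate e)
      ; u#0    = λ e → u#0 (locate e)
      ; w#0    = λ e → w#0 (locate e)
      ; num′#0 = oldLabels#0
      ; lift   = λ e → lift (locate e) (locate (φ T e))
      }
      where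
      module O = Dynamics oldLabels
      u#0 : ∀ {e} (l : Location e) → u l # 0#
      u#0     (surviving _ _) = 1#0
      u#0 {e} (removed _ _ _) = nz e
      w#0 : ∀ {e} (l : Location e) → w l # 0#
      w#0     (surviving _ _) = 1#0
      w#0 {e} (removed _ _ _) = #-congʳ (reflexive (≡.sym (den≡num-σ• T e))) (nz (σ• T e))
      lift : ∀ {e} (l : Location e) (l′ : Location (φ T e)) → ∃[ k ] target l′ ≡ O.walk (target l) k ×
        D.num e * O.along O.den (target l) k * (u l′ * w l) ≈
        O.along O.num (target l) k * D.den e * (u l * w l′)
      lift {e} (removed s t eq) (surviving s′ eq′) =
        0 , ι-injective (≡.trans eq′ (≡.sym eq)) ,
        solve 3 (λ p q i → (p ⊕ i) ⊕ (i ⊕ q) ⊜ (i ⊕ q) ⊕ (p ⊕ i)) refl (D.num e) (D.den e) 1#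
      lift (removed s t eq) (removed s′ t′ eq′) = contradiction t′ (twin-successor-survives t)
      lift (surviving s ≡.refl) l′ with classify s
      lift (surviving s ≡.refl) (surviving s′ eq′) | direct eq =
        1 , ι-injective (≡.trans eq′ (≡.sym eq)) , *-congʳ (begin
        D.num (ι s) * (1# * O.den s)
          ≈⟨ *-congˡ (*-congˡ (reflexive (≡.cong (λ e → pair (H (ι s)) (P e)) eq))) ⟩
        D.num (ι s) * (1# * D.den (ι s))
          ≈⟨ solve 3 (λ p e q → p ⊕ (e ⊕ q) ⊜ (e ⊕ p) ⊕ q) refl (D.num (ι s)) 1# (D.den (ι s)) ⟩
        1# * O.num s * D.den (ι s) ∎)
      lift (surviving s ≡.refl) (removed s′ t′ eq′) | direct eq = contradiction eq (ι-not-twin t′)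
      lift (surviving s ≡.refl) (surviving s′ eq′) | detour t φ≡y eq h∥k =
        contradiction (≡.trans eq′ φ≡y) (ι-not-twin (twins-sym t))
      -- The single step of `T′` is charged to the step onto `y`, whose potential supplies the
      -- factor of the second half of the detour.
      lift (surviving s ≡.refl) (removed s′ t′ eq′) | detour {y = y} t ≡.refl eq h∥k =
        1 , ι-injective (≡.trans eq′ (≡.sym eq)) , (begin
        D.num (ι s) * (1# * O.den s) * (D.num y * 1#)
          ≈⟨ *-congʳ (*-congˡ (*-congˡ (reflexive (≡.cong (λ e → pair (H (ι s)) (P e)) eq)))) ⟩
        D.num (ι s) * (1# * pair (H (ι s)) (P (φ T y))) * (D.num y * 1#)
          ≈⟨ solve 4 (λ p e q r → (p ⊕ (e ⊕ q)) ⊕ (r ⊕ e) ⊜ (q ⊕ r) ⊕ (p ⊕ (e ⊕ e))) refl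
               (D.num (ι s)) 1# (pair (H (ι s)) (P (φ T y))) (D.num y) ⟩
        pair (H (ι s)) (P (φ T y)) * D.num y * (D.num (ι s) * (1# * 1#))
          ≈⟨ *-congʳ (h∥k (vec (P (φ T y))) (vec (P y))) ⟩
        pair (H (ι s)) (P y) * D.den y * (D.num (ι s) * (1# * 1#))
          ≈⟨ solve 4 (λ p e q r → (q ⊕ r) ⊕ (p ⊕ (e ⊕ e)) ⊜ ((e ⊕ p) ⊕ q) ⊕ (e ⊕ r)) refl
               (D.num (ι s)) 1# (pair (H (ι s)) (P y)) (D.den y) ⟩
        1# * O.num s * D.den (ι s) * (1# * D.den y) ∎)

  -- Urban renewal

  module Urban {T T′} (U : UrbanRenewal T T′) (bal : Balanced T)
               (nz : NonzeroPairings T) (nz′ : NonzeroPairings T′) where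
    open UrbanRenewal U
    private
      module D = Dynamics (dynamics T)

    H : Edge T → Hyperplane
    H = hyperplaneAt T

    P : Edge T → Point
    P = pointAt T

    H-cB : H cB ≡ cₕ
    H-cB = ≡.trans (≡.cong H (≡.sym corner-c)) (hyperplaneAt-σ• T Ac)

    H-dA : H dA ≡ dₕ
    H-dA = ≡.trans (≡.cong H (≡.sym corner-d)) (hyperplaneAt-σ• T Bd)

    P-cB : P cB ≡ B
    P-cB = ≡.trans (≡.sym (pointAt-σ∘ T cB)) (≡.cong P corner-B)

    P-dA : P dA ≡ A
    P-dA = ≡.trans (≡.sym (pointAt-σ∘ T dA)) (≡.cong P corner-A)

    OnLine : Point → Set (c ⊔ ℓ₁)
    OnLine X = (⟨ A ⟩ ∨ ⟨ B ⟩) (vec X)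

    InPencil : Hyperplane → Set (c ⊔ ℓ₁)
    InPencil k = ∀ x → c∩d x → ker k x

    self : ∀ X → ⟨ X ⟩ (vec X)
    self X = 1# , λ j → sym (*-identityˡ _)

    origin-on : ∀ X → ⟨ X ⟩ (λ _ → 0#)
    origin-on X = 0# , λ j → sym (zeroˡ _)

    A-on : OnLine A
    A-on = vec A , (λ _ → 0#) , self A , origin-on B , λ j → sym (+-identityʳ _)

    B-on : OnLine B
    B-on = (λ _ → 0#) , vec B , origin-on A , self B , λ j → sym (+-identityˡ _)

    E-on : OnLine E
    E-on = proj₁ (proj₂ E-label (self E))

    F-on : OnLine F
    F-on = proj₁ (proj₂ F-label (self F))

    c-in : InPencil cₕ
    c-in _ = proj₁

    d-in : InPencil dₕ
    d-in _ = proj₂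

    apply-0 : ∀ ℓ → apply ℓ (λ _ → 0#) ≈ 0#
    apply-0 ℓ = trans (∑.sum-cong-≋ (λ j → zeroʳ (vec ℓ j))) (∑-zero (suc d))

    g-in : InPencil g
    g-in x x∈c∩d = proj₁ g-label
      (x , (λ _ → 0#) , x∈c∩d , (λ e _ → apply-0 (H e)) , λ j → sym (+-identityʳ _))

    h-in : InPencil h
    h-in x x∈c∩d = proj₁ h-label
      (x , (λ _ → 0#) , x∈c∩d , (λ e _ → apply-0 (H e)) , λ j → sym (+-identityʳ _))

    pair-line : ∀ X ((_ , _ , (x , _) , (y , _) , _) : OnLine X) → ∀ ℓ →
                pair ℓ X ≈ x * pair ℓ A + y * pair ℓ B
    pair-line X (u , v , (x , u≈) , (y , v≈) , X≈) ℓ = begin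
      pair ℓ X                    ≈⟨ apply-cong ℓ X≈ ⟩
      apply ℓ (λ j → u j + v j)   ≈⟨ apply-+ ℓ u v ⟩
      apply ℓ u + apply ℓ v       ≈⟨ +-cong (trans (apply-cong ℓ u≈) (apply-* ℓ x (vec A)))
                                            (trans (apply-cong ℓ v≈) (apply-* ℓ y (vec B))) ⟩
      x * pair ℓ A + y * pair ℓ B ∎

    -- Both sides are linear in the vector of `X`, which is a combination of those of `A` and `B`.
    line-extend : ∀ {p q} → p * pair dₕ A ≈ pair cₕ A * q → p * pair dₕ B ≈ pair cₕ B * q →
                  ∀ X → OnLine X → p * pair dₕ X ≈ pair cₕ X * q
    line-extend {p} {q} onA onB X X-on@(_ , _ , (x , _) , (y , _) , _) = begin
      p * pair dₕ X
        ≈⟨ *-congˡ (pair-line X X-on dₕ) ⟩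
      p * (x * pair dₕ A + y * pair dₕ B)
        ≈⟨ distribˡ p _ _ ⟩
      p * (x * pair dₕ A) + p * (y * pair dₕ B)
        ≈⟨ +-cong (move x onA) (move y onB) ⟩
      x * pair cₕ A * q + y * pair cₕ B * q
        ≈⟨ distribʳ q _ _ ⟨
      (x * pair cₕ A + y * pair cₕ B) * q
        ≈⟨ *-congʳ (pair-line X X-on cₕ) ⟨
      pair cₕ X * q ∎
      where
      move : ∀ x {s t} → p * s ≈ t * q → p * (x * s) ≈ x * t * q
      move x {s} {t} eq = begin
        p * (x * s) ≈⟨ solve 3 (λ p x s → p ⊕ (x ⊕ s) ⊜ x ⊕ (p ⊕ s)) refl p x s ⟩
        x * (p * s) ≈⟨ *-congˡ eq ⟩
        x * (t * q) ≈⟨ *-assoc x t q ⟨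
        x * t * q   ∎

    square-balanced : pair cₕ A * pair dₕ B ≈ pair cₕ B * pair dₕ A
    square-balanced = begin
      pair cₕ A * pair dₕ B
        ≈⟨ *-cong (sym (*-identityˡ _)) (reflexive (≡.cong D.num (≡.sym φAc))) ⟩
      1# * D.num Ac * D.num (φ T Ac)
        ≈⟨ bal Ac 2 (≡.trans (≡.cong (φ T) φAc) φBd) ⟩
      1# * D.den Ac * D.den (φ T Ac)
        ≈⟨ *-cong (*-identityˡ _) (reflexive (≡.cong D.den φAc)) ⟩
      D.den Ac * D.den Bd
        ≈⟨ *-cong (reflexive (≡.cong (λ e → pair cₕ (P e)) φAc))
                  (reflexive (≡.cong (λ e → pair dₕ (P e)) φBd)) ⟩
      pair cₕ B * pair dₕ A ∎
      where
      φAc : φ T Ac ≡ Bd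
      φAc = ≡.trans (≡.cong (σ∘ T) corner-c) corner-B
      φBd : φ T Bd ≡ Ac
      φBd = ≡.trans (≡.cong (σ∘ T) corner-d) corner-A

    -- The difference of the two sides is an alternating bilinear form on the span of `A` and `B`.
    -- It vanishes at the pair `A`, `B` by coherence of the square, hence everywhere: first `X` is
    -- extended, then `Y`.
    cd-exchange : ∀ X Y → OnLine X → OnLine Y →
                  pair cₕ X * pair dₕ Y ≈ pair cₕ Y * pair dₕ X
    cd-exchange X Y X-on Y-on = line-extend
      (sym (line-extend refl square-balanced X X-on))
      (sym (line-extend (sym square-balanced) refl X X-on))
      Y Y-on

    -- The vector c(Y) X - c(X) Y lies in c ∩ d, hence in k.
    c-exchange : ∀ k → InPencil k → ∀ X Y → OnLine X → OnLine Y →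
                 pair cₕ Y * pair k X ≈ pair cₕ X * pair k Y
    c-exchange k k-in X Y X-on Y-on = GroupProperties.x∙y⁻¹≈ε⇒x≈y +-group _ _ (begin
      pair cₕ Y * pair k X - pair cₕ X * pair k Y  ≈⟨ apply-v k ⟨
      apply k v                                   ≈⟨ k-in v (v∈c , v∈d) ⟩
      0#                                          ∎)
      where
      v : Vector
      v j = pair cₕ Y * vec X j + - pair cₕ X * vec Y j
      apply-v : ∀ ℓ → apply ℓ v ≈ pair cₕ Y * pair ℓ X - pair cₕ X * pair ℓ Y
      apply-v ℓ = begin
        apply ℓ v
          ≈⟨ apply-+ ℓ (λ j → pair cₕ Y * vec X j) (λ j → - pair cₕ X * vec Y j) ⟩
        apply ℓ (λ j → pair cₕ Y * vec X j) + apply ℓ (λ j → - pair cₕ X * vec Y j)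
          ≈⟨ +-cong (apply-* ℓ _ (vec X)) (apply-* ℓ _ (vec Y)) ⟩
        pair cₕ Y * pair ℓ X + - pair cₕ X * pair ℓ Y
          ≈⟨ +-congˡ (RingProperties.-‿distribˡ-* ring _ _) ⟨
        pair cₕ Y * pair ℓ X - pair cₕ X * pair ℓ Y ∎
      v∈c : ker cₕ v
      v∈c = trans (apply-v cₕ) (trans (+-congʳ (*-comm _ _)) (-‿inverseʳ _))
      v∈d : ker dₕ v
      v∈d = trans (apply-v dₕ) (trans (+-congʳ (cd-exchange Y X Y-on X-on)) (-‿inverseʳ _))

    -- On the line both `k` and `l` are compared with `cₕ` through the point `A`, where `cₕ` is
    -- nonzero.
    exchange : ∀ k l → InPencil k → InPencil l → ∀ X Y → OnLine X → OnLine Y →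
               pair k X * pair l Y ≈ pair k Y * pair l X
    exchange k l k-in l-in X Y X-on Y-on =
      *-cancelˡ-# (x#0y#0→xy#0 (nz Ac) (nz Ac)) (begin
        pair cₕ A * pair cₕ A * (pair k X * pair l Y)
          ≈⟨ interchange _ _ _ _ ⟩
        (pair cₕ A * pair k X) * (pair cₕ A * pair l Y)
          ≈⟨ *-cong (c-exchange k k-in X A X-on A-on) (c-exchange l l-in Y A Y-on A-on) ⟩
        (pair cₕ X * pair k A) * (pair cₕ Y * pair l A)
          ≈⟨ solve 4 (λ a b c d → (a ⊕ b) ⊕ (c ⊕ d) ⊜ (c ⊕ b) ⊕ (a ⊕ d)) refl
               (pair cₕ X) (pair k A) (pair cₕ Y) (pair l A) ⟩
        (pair cₕ Y * pair k A) * (pair cₕ X * pair l A)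
          ≈⟨ *-cong (c-exchange k k-in Y A Y-on A-on) (c-exchange l l-in X A X-on A-on) ⟨
        (pair cₕ A * pair k Y) * (pair cₕ A * pair l X)
          ≈⟨ interchange _ _ _ _ ⟨
        pair cₕ A * pair cₕ A * (pair k Y * pair l X) ∎)
      where
      interchange : ∀ a b x y → (a * b) * (x * y) ≈ (a * x) * (b * y)
      interchange = solve 4 (λ a b x y → (a ⊕ b) ⊕ (x ⊕ y) ⊜ (a ⊕ x) ⊕ (b ⊕ y)) refl

    X : Set
    X = Edge T ⊎ NewEdge

    PX : X → Point
    PX = newPoint T A B E F

    HX : X → Hyperplane
    HX = newHyperplane T cₕ dₕ g h

    -- The four deleted edges are kept as states: no edge of T′ leads to them.
    new : Dynamics
    new = labelled X (newσ∘ ∘ newσ•) PX HX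

    private
      module N = Dynamics new

    new#0 : ∀ x → N.num x # 0#
    new#0 (inj₁ e) = nz e
    -- Every new edge occurs in `T′`, where its pairing is nonzero and differs from this one by
    -- scalars.
    new#0 (inj₂ n) with e′ , eq ← Equivalence.from (origin-image (inj₂ n)) tt =
      ≡.subst (λ x → N.num x # 0#) eq (xy#0→y#0 (#-congʳ
        (pair-scale (hyperplaneAt T′ e′) (HX (origin e′)) (pointAt T′ e′) (PX (origin e′))
          (hyperplanes e′) (points e′))
        (nz′ e′)))

    T′⇒new : Simulation (dynamics T′) new
    T′⇒new = relabel {P = pointAt T′} {hyperplaneAt T′} {PX} {HX} origin
      (λ e′ → ≡.trans (rotation∘ (σ• T′ e′)) (≡.cong newσ∘ (rotation• e′)))
      points hyperplanes new#0

    -- A face that bordered the square along `dA` now passes `A`, `g`, `F`, `d`: the states `Ag` and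
    -- `dF` share the edge `dA`. Along `Ac` it now passes `c`, `E`, `g`, `A`: the state `gE` already
    -- counts as the edge after `A`. The sides at `B` are alike. The inner square consists of `Eh`
    -- and `Fg` and rests at one edge, arbitrarily `Ac`.
    π : X → Edge T
    π (inj₁ e)  = e
    π (inj₂ Ag) = dA
    π (inj₂ cE) = cB
    π (inj₂ Bh) = cB
    π (inj₂ dF) = dA
    π (inj₂ gE) = σ∘ T Ac
    π (inj₂ hF) = σ∘ T Bd
    π (inj₂ Eh) = Ac
    π (inj₂ Fg) = Ac

    -- The edges to the inner square have to compensate for a corner A or B of the
    -- old square being replaced by E or F, e.g. c(E) / c(B) at cE.  By exchange it
    -- does not matter by which hyperplane through c ∩ d this is measured.
    u w : X → Carrier
    u (inj₂ cE) = pair cₕ E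
    u (inj₂ dF) = pair dₕ F
    u (inj₂ gE) = pair g E
    u (inj₂ hF) = pair h F
    u (inj₂ Eh) = pair g E
    u (inj₂ Fg) = pair g F
    u _         = 1#
    w (inj₂ cE) = pair cₕ B
    w (inj₂ dF) = pair dₕ A
    w (inj₂ gE) = pair g A
    w (inj₂ hF) = pair h B
    w _         = 1#

    num-cB : D.num cB ≡ pair cₕ B
    num-cB = ≡.cong₂ pair H-cB P-cB

    num-dA : D.num dA ≡ pair dₕ A
    num-dA = ≡.cong₂ pair H-dA P-dA

    u#0 : ∀ x → u x # 0#
    u#0 (inj₁ _)  = 1#0
    u#0 (inj₂ Ag) = 1#0
    u#0 (inj₂ Bh) = 1#0
    u#0 (inj₂ cE) = new#0 (inj₂ cE)
    u#0 (inj₂ dF) = new#0 (inj₂ dF)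
    u#0 (inj₂ gE) = new#0 (inj₂ gE)
    u#0 (inj₂ hF) = new#0 (inj₂ hF)
    u#0 (inj₂ Eh) = new#0 (inj₂ gE)
    u#0 (inj₂ Fg) = new#0 (inj₂ Fg)

    w#0 : ∀ x → w x # 0#
    w#0 (inj₁ _)  = 1#0
    w#0 (inj₂ Ag) = 1#0
    w#0 (inj₂ Bh) = 1#0
    w#0 (inj₂ cE) = #-congʳ (reflexive num-cB) (nz cB)
    w#0 (inj₂ dF) = #-congʳ (reflexive num-dA) (nz dA)
    w#0 (inj₂ gE) = new#0 (inj₂ Ag)
    w#0 (inj₂ hF) = new#0 (inj₂ Bh)
    w#0 (inj₂ Eh) = 1#0
    w#0 (inj₂ Fg) = 1#0

    Lift : X → Set ℓ₁
    Lift x = ∃[ k ] π (N.step x) ≡ D.walk (π x) k ×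
      N.num x * D.along D.den (π x) k * (u (N.step x) * w x) ≈
      D.along D.num (π x) k * N.den x * (u x * w (N.step x))

    stay : ∀ x → π (N.step x) ≡ π x → N.num x * (u (N.step x) * w x) ≈ N.den x * (u x * w (N.step x)) →
           Lift x
    stay x eq balance = 0 , eq , (begin
      N.num x * 1# * (u (N.step x) * w x)   ≈⟨ *-congʳ (*-identityʳ _) ⟩
      N.num x * (u (N.step x) * w x)        ≈⟨ balance ⟩
      N.den x * (u x * w (N.step x))        ≈⟨ *-congʳ (*-identityˡ _) ⟨
      1# * N.den x * (u x * w (N.step x))   ∎)

    -- Holds for the states that leave their black end as `π x` does in `T`: the old edges, and the
    -- legs `cE` and `dF` in place of `cB` and `dA`.
    record OnBase (x : X) : Set (c ⊔ ℓ₁ ⊔ ℓ₂) where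
      field
        πx-hyperplane : HX x ≡ H (π x)
        πx-rotation   : newσ• x ≡ leg• (σ• T (π x))
        πx-weight     : N.num x * w x ≈ D.num (π x) * u x

    advance : ∀ x → OnBase x → ∀ y → N.step x ≡ y → π y ≡ φ T (π x) →
              D.den (π x) * u y ≈ pair (H (π x)) (PX y) * w y → Lift x
    advance x base y ≡.refl eq balance = 1 , eq , (begin
      N.num x * (1# * D.den (π x)) * (u y * w x)
        ≈⟨ solve 5 (λ p i q u w → (p ⊕ (i ⊕ q)) ⊕ (u ⊕ w) ⊜ (i ⊕ (p ⊕ w)) ⊕ (q ⊕ u))
             refl (N.num x) 1# (D.den (π x)) (u y) (w x) ⟩
      1# * (N.num x * w x) * (D.den (π x) * u y)
        ≈⟨ *-cong (*-congˡ πx-weight) (trans balance (reflexive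
             (≡.cong (λ k → pair k (PX y) * w y) (≡.sym πx-hyperplane)))) ⟩
      1# * (D.num (π x) * u x) * (N.den x * w y)
        ≈⟨ solve 5 (λ p i q u w → (i ⊕ (p ⊕ u)) ⊕ (q ⊕ w) ⊜ ((i ⊕ p) ⊕ q) ⊕ (u ⊕ w))
             refl (D.num (π x)) 1# (N.den x) (u x) (w y) ⟩
      1# * D.num (π x) * N.den x * (u x * w y) ∎)
      where open OnBase base

    leg•-cases : ∀ e → (e ≡ Ac × leg• e ≡ inj₂ cE) ⊎ (e ≡ Bd × leg• e ≡ inj₂ dF) ⊎ leg• e ≡ inj₁ e
    leg•-cases e with e ≟ Ac | e ≟ Bd
    ... | yes e≡Ac | _        = inj₁ (e≡Ac , ≡.refl)
    ... | no _     | yes e≡Bd = inj₂ (inj₁ (e≡Bd , ≡.refl))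
    ... | no _     | no _     = inj₂ (inj₂ ≡.refl)

    record IsLeg∘ (e : Edge T) (x : X) : Set (c ⊔ ℓ₂) where
      field
        π-leg     : π x ≡ e
        point-leg : PX x ≡ P e
        u-leg     : u x ≡ 1#
        w-leg     : w x ≡ 1#

    isLeg∘ : ∀ e → IsLeg∘ e (leg∘ e)
    isLeg∘ e with e ≟ dA | e ≟ cB
    ... | yes ≡.refl | _ = record { π-leg = ≡.refl ; point-leg = ≡.sym P-dA ; u-leg = ≡.refl ; w-leg = ≡.refl }
    ... | no _ | yes ≡.refl = record { π-leg = ≡.refl ; point-leg = ≡.sym P-cB ; u-leg = ≡.refl ; w-leg = ≡.refl }
    ... | no _ | no _ = record { π-leg = ≡.refl ; point-leg = ≡.refl ; u-leg = ≡.refl ; w-leg = ≡.refl }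

    lift-base : ∀ x → OnBase x → Lift x
    lift-base x base = go (leg•-cases (σ• T (π x)))
      where
      open OnBase base
      e = π x
      go : _ → Lift x
      -- The rotation at `c` meets the leg `cE` instead of `Ac`, so the next point is `E` instead of
      -- `A`; `exchange` measures this change by `g`, as the potential at `gE` does.
      go (inj₁ (e≡Ac , eq)) = advance x base (inj₂ gE)
        (≡.cong newσ∘ (≡.trans πx-rotation eq)) (≡.cong (σ∘ T) (≡.sym e≡Ac)) (begin
          D.den e * pair g E
            ≈⟨ *-congʳ (reflexive (≡.trans (den≡num-σ• T e) (≡.cong D.num e≡Ac))) ⟩
          pair cₕ A * pair g E
            ≈⟨ exchange cₕ g c-in g-in A E A-on E-on ⟩
          pair cₕ E * pair g A
            ≈⟨ *-congʳ (reflexive (≡.cong (λ k → pair k E)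
                 (≡.trans (≡.sym (≡.cong H e≡Ac)) (hyperplaneAt-σ• T e)))) ⟩
          pair (H e) E * pair g A ∎)
      go (inj₂ (inj₁ (e≡Bd , eq))) = advance x base (inj₂ hF)
        (≡.cong newσ∘ (≡.trans πx-rotation eq)) (≡.cong (σ∘ T) (≡.sym e≡Bd)) (begin
          D.den e * pair h F
            ≈⟨ *-congʳ (reflexive (≡.trans (den≡num-σ• T e) (≡.cong D.num e≡Bd))) ⟩
          pair dₕ B * pair h F
            ≈⟨ exchange dₕ h d-in h-in B F B-on F-on ⟩
          pair dₕ F * pair h B
            ≈⟨ *-congʳ (reflexive (≡.cong (λ k → pair k F)
                 (≡.trans (≡.sym (≡.cong H e≡Bd)) (hyperplaneAt-σ• T e)))) ⟩
          pair (H e) F * pair h B ∎)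
      go (inj₂ (inj₂ eq)) = advance x base (leg∘ (φ T e))
        (≡.cong newσ∘ (≡.trans πx-rotation eq)) π-leg
        (*-cong (reflexive (≡.cong (pair (H e)) (≡.sym point-leg)))
                (reflexive (≡.trans u-leg (≡.sym w-leg))))
        where open IsLeg∘ (isLeg∘ (φ T e))

    lift : ∀ x → Lift x
    lift (inj₁ e)  = lift-base (inj₁ e) record
      { πx-hyperplane = ≡.refl ; πx-rotation = ≡.refl ; πx-weight = refl }
    lift (inj₂ cE) = lift-base (inj₂ cE) record
      { πx-hyperplane = ≡.sym H-cB
      ; πx-rotation   = ≡.refl
      ; πx-weight     = trans (*-comm _ _) (*-congʳ (reflexive (≡.sym num-cB)))
      }
    lift (inj₂ dF) = lift-base (inj₂ dF) record
      { πx-hyperplane = ≡.sym H-dA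
      ; πx-rotation   = ≡.refl
      ; πx-weight     = trans (*-comm _ _) (*-congʳ (reflexive (≡.sym num-dA)))
      }
    -- Coherence of the quadrilateral `A`, `g`, `F`, `d`, half of which sits in the potential at
    -- `dF`.
    lift (inj₂ Ag) = stay (inj₂ Ag) ≡.refl (begin
      pair g A * (pair dₕ F * 1#)  ≈⟨ *-congˡ (*-identityʳ _) ⟩
      pair g A * pair dₕ F         ≈⟨ exchange g dₕ g-in d-in A F A-on F-on ⟩
      pair g F * pair dₕ A         ≈⟨ *-congˡ (*-identityˡ _) ⟨
      pair g F * (1# * pair dₕ A)  ∎)
    lift (inj₂ Bh) = stay (inj₂ Bh) ≡.refl (begin
      pair h B * (pair cₕ E * 1#)  ≈⟨ *-congˡ (*-identityʳ _) ⟩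
      pair h B * pair cₕ E         ≈⟨ exchange h cₕ h-in c-in B E B-on E-on ⟩
      pair h E * pair cₕ B         ≈⟨ *-congˡ (*-identityˡ _) ⟨
      pair h E * (1# * pair cₕ B)  ∎)
    lift (inj₂ gE) = stay (inj₂ gE) π-leg (begin
      pair g E * (u leg * pair g A)
        ≈⟨ solve 3 (λ a u b → a ⊕ (u ⊕ b) ⊜ b ⊕ (a ⊕ u)) refl (pair g E) (u leg) (pair g A) ⟩
      pair g A * (pair g E * u leg)
        ≈⟨ *-cong (reflexive (≡.cong (pair g) (≡.sym (≡.trans point-leg (pointAt-σ∘ T Ac)))))
                  (*-congˡ (reflexive (≡.trans u-leg (≡.sym w-leg)))) ⟩
      pair g (PX leg) * (pair g E * w leg) ∎)
      where
      leg = leg∘ (σ∘ T Ac)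
      open IsLeg∘ (isLeg∘ (σ∘ T Ac))
    lift (inj₂ hF) = stay (inj₂ hF) π-leg (begin
      pair h F * (u leg * pair h B)
        ≈⟨ solve 3 (λ a u b → a ⊕ (u ⊕ b) ⊜ b ⊕ (a ⊕ u)) refl (pair h F) (u leg) (pair h B) ⟩
      pair h B * (pair h F * u leg)
        ≈⟨ *-cong (reflexive (≡.cong (pair h) (≡.sym (≡.trans point-leg (pointAt-σ∘ T Bd)))))
                  (*-congˡ (reflexive (≡.trans u-leg (≡.sym w-leg)))) ⟩
      pair h (PX leg) * (pair h F * w leg) ∎)
      where
      leg = leg∘ (σ∘ T Bd)
      open IsLeg∘ (isLeg∘ (σ∘ T Bd))
    -- Around the inner square the factors are the coboundary of the values of `g` at `E` and `F`;
    -- at `Eh`, `exchange` replaces `h` by `g`.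
    lift (inj₂ Fg) = stay (inj₂ Fg) ≡.refl
      (solve 3 (λ a b i → a ⊕ (b ⊕ i) ⊜ b ⊕ (a ⊕ i)) refl (pair g F) (pair g E) 1#)
    lift (inj₂ Eh) = stay (inj₂ Eh) ≡.refl (begin
      pair h E * (pair g F * 1#)  ≈⟨ *-assoc _ _ _ ⟨
      pair h E * pair g F * 1#    ≈⟨ *-congʳ (exchange h g h-in g-in E F E-on F-on) ⟩
      pair h F * pair g E * 1#    ≈⟨ *-assoc _ _ _ ⟩
      pair h F * (pair g E * 1#)  ∎)

    new⇒T : Simulation new (dynamics T)
    new⇒T = record
      { π = π ; u = u ; w = w ; u#0 = u#0 ; w#0 = w#0 ; num′#0 = nz ; lift = lift }

  -- Invariance of coherence under every move

  module _ {T T′} (R : WhiteRemoval T T′) (dc : DoubleCircuit T) (nz : NonzeroPairings T) where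
    open WhiteRemoval R
    open Removal R dc nz

    removal-balanced : Balanced T → Balanced T′
    removal-balanced = Simulation.balanced
        (relabel {P = pointAt T′} {hyperplaneAt T′} {P ∘ ι} {H ∘ ι} (λ e → e) (λ _ → ≡.refl)
          points hyperplanes oldLabels#0)
                     ∘ Simulation.balanced oldLabels⇒T

    addition-balanced : NonzeroPairings T′ → Balanced T′ → Balanced T
    addition-balanced nz′ = Simulation.balanced T⇒oldLabels ∘ Simulation.balanced
      (relabel {P = P ∘ ι} {H ∘ ι} {pointAt T′} {hyperplaneAt T′} (λ e → e) (λ _ → ≡.refl)
        (λ e → ≈ₚ-sym {pointAt T′ e} {P (ι e)} (points e))
        (λ e → ≈ₚ-sym {hyperplaneAt T′ e} {H (ι e)} (hyperplanes e)) nz′)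

  -- Moves at black vertices are moves at white ones between the swapped tilings, and swapping twice
  -- gives the tiling back by definition. An addition is a removal from `T′` to `T`, so there the
  -- circuit condition is that of `T′`.
  move-balanced : ∀ {T T′} → Move T T′ → DoubleCircuit T → DoubleCircuit T′ →
                  NonzeroPairings T → NonzeroPairings T′ → Balanced T → Balanced T′
  move-balanced (white-removal R) dc dc′ nz nz′ = removal-balanced R dc nz
  move-balanced (white-addition R) dc dc′ nz nz′ = addition-balanced R dc′ nz′ nz
  move-balanced {T} {T′} (black-removal R) dc dc′ nz nz′ =
      Balanced-swapColors (swapColors T′) (NonzeroPairings-swapColors T′ nz′)
    ∘ removal-balanced R (DoubleCircuit-swapColors T dc) (NonzeroPairings-swapColors T nz)
    ∘ Balanced-swapColors T nz
  move-balanced {T} {T′} (black-addition R) dc dc′ nz nz′ =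
      Balanced-swapColors (swapColors T′) (NonzeroPairings-swapColors T′ nz′)
    ∘ addition-balanced R (DoubleCircuit-swapColors T′ dc′)
        (NonzeroPairings-swapColors T′ nz′) (NonzeroPairings-swapColors T nz)
    ∘ Balanced-swapColors T nz
  move-balanced (urban-renewal U) dc dc′ nz nz′ bal =
    Simulation.balanced T′⇒new (Simulation.balanced new⇒T bal)
    where open Urban U bal nz nz′

mainTheorem1 : ∀ {c ℓ₁ ℓ₂} (K : HeytingField c ℓ₁ ℓ₂) (d : ℕ) →
    let open Tilings K d in
    2 ≤ d → (T T′ : Tiling) → Coherent T → DoubleCircuit T →
    Move T T′ → DoubleCircuit T′ → NonzeroPairings T′ → Coherent T′
mainTheorem1 K d _ T T′ coherent dc move dc′ nz′ F =
  balanced⇒coherentFace T′ F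
    (move-balanced move dc dc′ (coherent⇒nonzeroPairings T coherent) nz′
      (coherent⇒balanced T coherent))
    nz′
  where open TilingDynamics K d
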